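{- Let $p$ be a prime, $n\ge 1$ an integer and $q=p^n$. Let $f:\mathbb{F}_q\to\mathbb{F}_q$ be a map of additive index $p^k$. Then $$\mathrm{w}(f)\le \begin{cases} n+1, & k=0,\\[4pt] \left(\dfrac{(n-k+1)^p-1}{n-k}\right)^k, & 1\le k<n.\end{cases}$$
   Context: Weight: every map $f:\mathbb{F}_q\to\mathbb{F}_q$ coincides on $\mathbb{F}_q$ with a unique polynomial $P_f\in\mathbb{F}_q[x]$ of degree at most $q-1$; the weight $\mathrm{w}(f)$ is the number of nonzero coefficients of $P_f$. Additive index: view $\mathbb{F}_q$ as an $n$-dimensional vector space over $\mathbb{F}_p$. A map $f:\mathbb{F}_q\to\mathbb{F}_q$ is of codimension at most $k$ ($0\le k\le n$) if there are an $\mathbb{F}_p$-linear map $M:\mathbb{F}_q\to\mathbb{F}_q$ (equivalently, a map induced by a linearised polynomial $\sum_j a_jX^{p^j}$, $a_j\in\mathbb{F}_q$) and an $\mathbb{F}_p$-subspace $U$ of $\mathbb{F}_q$ of dimension $n-k$ such that $f-M$ is constant on each coset of $U$. The codimension $\mathrm{codim}\, f$ is the smallest such $k$, and the additive index of $f$ is $\mathrm{AddInd}(f)=p^{\mathrm{codim}\, f}$. -}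

module Defs where

open import Algebra.Bundles using (CommutativeRing)
open import Algebra.Definitions using (Invertible)
open import Algebra.Module.Bundles.Raw using (RawLeftModule)
open import Algebra.Module.Morphism.Structures using (module LeftModuleMorphisms)
import Algebra.Properties.Group
import Algebra.Properties.Ring
import Algebra.Properties.Semiring.Exp
import Algebra.Properties.Semiring.Mult
import Algebra.Properties.Semiring.Sum
import Algebra.Solver.Ring.NaturalCoefficients.Default
open import Data.Fin using (Fin; zero; suc; toℕ)
import Data.Fin.Properties as Fin
open import Data.Nat using (ℕ; zero; suc; NonZero; _∸_; _^_; _≤_)
open import Data.Product using (_×_; _,_; proj₁; proj₂; Σ-syntax; ∃-syntax; ∃!)
open import Data.Vec using (count; tabulate)
open import Data.Vec.Functional using (Vector; []; _∷_; head; tail)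
import Data.Vec.Functional.Relation.Binary.Equality.Setoid
open import Function using (Func; Inverse; _∘_)
open import Function.Definitions using (Injective)
import Function.Properties.Inverse
open import Level using (Level; _⊔_) renaming (suc to lsuc)
open import Relation.Binary using (Decidable; _Respects_)
open import Relation.Binary.PropositionalEquality as ≡ using (_≡_)
open import Relation.Nullary using (¬_; ¬?)
open import Relation.Nullary.Decidable using (via-injection)
open import Relation.Unary using (Pred; _∈_)

record FiniteField c ℓ (q : ℕ) : Set (lsuc (c ⊔ ℓ)) where
  field
    commutativeRing : CommutativeRing c ℓ

  open CommutativeRing commutativeRing public

  field
    0≉1         : ¬ (0# ≈ 1#)
    invertible  : ∀ {x} → ¬ (x ≈ 0#) → Invertible _≈_ 1# _*_ x
    enumeration : Inverse setoid (≡.setoid (Fin q))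

  infix 4 _≟_

  _≟_ : Decidable _≈_
  _≟_ = via-injection (Function.Properties.Inverse.Inverse⇒Injection enumeration) Fin._≟_

module Weight {c ℓ : Level} {q : ℕ} (F : FiniteField c ℓ q) where

  open FiniteField F hiding (zero)
  open Algebra.Properties.Ring ring using (-0#≈0#; -‿distribʳ-*; -‿+-comm)
  open Algebra.Properties.Group +-group using ()
    renaming (x≈y⇒x∙y⁻¹≈ε to x≈y⇒x-y≈0; x∙y⁻¹≈ε⇒x≈y to x-y≈0⇒x≈y)
  open Algebra.Properties.Semiring.Exp semiring using (^-congˡ) renaming (_^_ to _^ᶠ_)
  open Algebra.Properties.Semiring.Sum semiring
    using (sum-syntax; sum-cong-≋; ∑-distrib-+; *-distribˡ-sum)
  open Algebra.Solver.Ring.NaturalCoefficients.Default commutativeSemiring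
    using (solve; _:+_; _:*_; _:=_)
  open Data.Vec.Functional.Relation.Binary.Equality.Setoid setoid using (_≋_)
  open import Relation.Binary.Reasoning.Setoid setoid

  -- A vector of m coefficients is a polynomial of degree < m; here 0 ^ᶠ 0 = 1.
  eval : ∀ {m} → Vector Carrier m → Carrier → Carrier
  eval {m} P x = ∑[ i < m ] (P i * x ^ᶠ toℕ i)

  Interpolates : ∀ {m} → Func setoid setoid → Vector Carrier m → Set (c ⊔ ℓ)
  Interpolates f P = ∀ x → eval P x ≈ Func.to f x

  eval-suc : ∀ {m} (P : Vector Carrier (suc m)) x →
             eval P x ≈ head P + x * eval (tail P) x
  eval-suc {m} P x = +-cong (*-identityʳ (head P)) (begin
    ∑[ i < m ] (tail P i * (x * x ^ᶠ toℕ i))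
      ≈⟨ sum-cong-≋ (λ i → solve 3 (λ a y z → a :* (y :* z) := y :* (a :* z)) refl
                             (tail P i) x (x ^ᶠ toℕ i)) ⟩
    ∑[ i < m ] (x * (tail P i * x ^ᶠ toℕ i))
      ≈⟨ *-distribˡ-sum x (λ i → tail P i * x ^ᶠ toℕ i) ⟨
    x * eval (tail P) x ∎)

  eval-+ : ∀ {m} (P Q : Vector Carrier m) x →
           eval (λ i → P i + Q i) x ≈ eval P x + eval Q x
  eval-+ P Q x = trans
    (sum-cong-≋ (λ i → distribʳ (x ^ᶠ toℕ i) (P i) (Q i)))
    (∑-distrib-+ (λ i → P i * x ^ᶠ toℕ i) (λ i → Q i * x ^ᶠ toℕ i))

  eval-- : ∀ {m} (P : Vector Carrier m) x → eval (λ i → - P i) x ≈ - eval P x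
  eval-- {zero}  P x = sym -0#≈0#
  eval-- {suc m} P x = begin
    eval (λ i → - P i) x                         ≈⟨ eval-suc (λ i → - P i) x ⟩
    - head P + x * eval (λ i → - tail P i) x     ≈⟨ +-congˡ (*-congˡ (eval-- (tail P) x)) ⟩
    - head P + x * - eval (tail P) x             ≈⟨ +-congˡ (-‿distribʳ-* x _) ⟨
    - head P + - (x * eval (tail P) x)           ≈⟨ -‿+-comm (head P) _ ⟩
    - (head P + x * eval (tail P) x)             ≈⟨ -‿cong (eval-suc P x) ⟨
    - eval P x                                   ∎

  cancel : ∀ {x y} → ¬ (x ≈ 0#) → x * y ≈ 0# → y ≈ 0#
  cancel {x} {y} x≉0 xy≈0 with invertible x≉0
  ... | z , zx≈1 , _ = begin
    y            ≈⟨ *-identityˡ y ⟨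
    1# * y       ≈⟨ *-congʳ zx≈1 ⟨
    (z * x) * y  ≈⟨ *-assoc z x y ⟩
    z * (x * y)  ≈⟨ *-congˡ xy≈0 ⟩
    z * 0#       ≈⟨ zeroʳ z ⟩
    0#           ∎

  -- The coefficients of b + (X - a) Q.
  expand : ∀ {m} → Carrier → Carrier → Vector Carrier m → Vector Carrier (suc m)
  expand {zero}  b a Q = b ∷ []
  expand {suc m} b a Q = (b + - a * head Q) ∷ expand (head Q) a (tail Q)

  eval-expand : ∀ {m} b a (Q : Vector Carrier m) x →
                eval (expand b a Q) x ≈ b + (x - a) * eval Q x
  eval-expand {zero}  b a Q x = begin
    b * 1# + 0#          ≈⟨ +-cong (*-identityʳ b) (sym (zeroʳ (x - a))) ⟩
    b + (x - a) * 0#     ∎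
  eval-expand {suc m} b a Q x = begin
    eval (expand b a Q) x
      ≈⟨ eval-suc (expand b a Q) x ⟩
    (b + - a * q₀) + x * eval (expand q₀ a (tail Q)) x
      ≈⟨ +-congˡ (*-congˡ (eval-expand q₀ a (tail Q) x)) ⟩
    (b + - a * q₀) + x * (q₀ + (x - a) * t)
      ≈⟨ solve 5 (λ b a q₀ x t → (b :+ a :* q₀) :+ x :* (q₀ :+ (x :+ a) :* t)
                               := b :+ (x :+ a) :* (q₀ :+ x :* t))
           refl b (- a) q₀ x t ⟩
    b + (x - a) * (q₀ + x * t)
      ≈⟨ +-congˡ (*-congˡ (eval-suc Q x)) ⟨
    b + (x - a) * eval Q x ∎
    where
    q₀ = head Q
    t  = eval (tail Q) x

  interpolate : ∀ {m} (a v : Vector Carrier m) → Injective _≡_ _≈_ a →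
                Σ[ P ∈ Vector Carrier m ] (∀ i → eval P (a i) ≈ v i)
  interpolate {zero}  a v a-inj = [] , λ ()
  interpolate {suc m} a v a-inj = expand (head v) (head a) Q , correct
    where
    a-a₀≉0 : ∀ i → ¬ (tail a i - head a ≈ 0#)
    a-a₀≉0 i eq with a-inj (x-y≈0⇒x≈y _ _ eq)
    ... | ()

    inv : Vector Carrier m
    inv i = proj₁ (invertible (a-a₀≉0 i))

    slopes : Σ[ Q ∈ Vector Carrier m ]
               (∀ i → eval Q (tail a i) ≈ inv i * (tail v i - head v))
    slopes = interpolate (tail a) _ (λ eq → Fin.suc-injective (a-inj eq))

    Q : Vector Carrier m
    Q = proj₁ slopes

    correct : ∀ i → eval (expand (head v) (head a) Q) (a i) ≈ v i
    correct zero = begin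
      eval (expand (head v) (head a) Q) (head a)      ≈⟨ eval-expand (head v) (head a) Q (head a) ⟩
      head v + (head a - head a) * eval Q (head a)    ≈⟨ +-congˡ (*-congʳ (-‿inverseʳ (head a))) ⟩
      head v + 0# * eval Q (head a)                   ≈⟨ +-congˡ (zeroˡ _) ⟩
      head v + 0#                                     ≈⟨ +-identityʳ (head v) ⟩
      head v                                          ∎
    correct (suc i) = begin
      eval (expand (head v) (head a) Q) (tail a i)    ≈⟨ eval-expand (head v) (head a) Q (tail a i) ⟩
      head v + d * eval Q (tail a i)                  ≈⟨ +-congˡ (*-congˡ (proj₂ slopes i)) ⟩
      head v + d * (inv i * e)                        ≈⟨ +-congˡ (*-assoc d (inv i) e) ⟨
      head v + (d * inv i) * e                        ≈⟨ +-congˡ (*-congʳ (proj₂ (proj₂ (invertible (a-a₀≉0 i))))) ⟩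
      head v + 1# * e                                 ≈⟨ +-congˡ (*-identityˡ e) ⟩
      head v + (tail v i - head v)                    ≈⟨ +-comm (head v) e ⟩
      (tail v i - head v) + head v                    ≈⟨ +-assoc (tail v i) (- head v) (head v) ⟩
      tail v i + (- head v + head v)                  ≈⟨ +-congˡ (-‿inverseˡ (head v)) ⟩
      tail v i + 0#                                   ≈⟨ +-identityʳ (tail v i) ⟩
      tail v i                                        ∎
      where
      d = tail a i - head a
      e = tail v i - head v

  -- The quotient of P by X - a; the remainder is P(a).
  quotient : ∀ {m} → Carrier → Vector Carrier (suc m) → Vector Carrier m
  quotient {zero}  a P = []
  quotient {suc m} a P = eval (tail P) a ∷ quotient a (tail P)

  eval-quotient : ∀ {m} a (P : Vector Carrier (suc m)) x →
                  eval P x ≈ eval P a + (x - a) * eval (quotient a P) x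
  eval-quotient {zero}  a P x = sym (trans (+-congˡ (zeroʳ (x - a))) (+-identityʳ (eval P a)))
  eval-quotient {suc m} a P x = begin
    eval P x
      ≈⟨ eval-suc P x ⟩
    p₀ + x * eval (tail P) x
      ≈⟨ +-congˡ (*-congˡ (eval-quotient a (tail P) x)) ⟩
    p₀ + x * (y + (x - a) * t)
      ≈⟨ +-identityʳ _ ⟨
    p₀ + x * (y + (x - a) * t) + 0#
      ≈⟨ +-congˡ (trans (*-congʳ (-‿inverseʳ a)) (zeroˡ y)) ⟨
    p₀ + x * (y + (x - a) * t) + (a - a) * y
      ≈⟨ solve 6 (λ p₀ x y a n t → p₀ :+ x :* (y :+ (x :+ n) :* t) :+ (a :+ n) :* y
                                 := (p₀ :+ a :* y) :+ (x :+ n) :* (y :+ x :* t))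
           refl p₀ x y a (- a) t ⟩
    (p₀ + a * y) + (x - a) * (y + x * t)
      ≈⟨ +-cong (eval-suc P a) (*-congˡ (eval-suc (quotient a P) x)) ⟨
    eval P a + (x - a) * eval (quotient a P) x ∎
    where
    p₀ = head P
    y  = eval (tail P) a
    t  = eval (quotient a (tail P)) x

  quotient≈0⇒≈0 : ∀ {m} a (P : Vector Carrier (suc m)) → eval P a ≈ 0# →
                  (∀ i → quotient a P i ≈ 0#) → ∀ i → P i ≈ 0#
  quotient≈0⇒≈0 {zero}  a P root Q≈0 zero = begin
    head P            ≈⟨ *-identityʳ (head P) ⟨
    head P * 1#       ≈⟨ +-identityʳ _ ⟨
    head P * 1# + 0#  ≈⟨ root ⟩
    0#                ∎
  quotient≈0⇒≈0 {suc m} a P root Q≈0 zero = begin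
    head P                          ≈⟨ +-identityʳ (head P) ⟨
    head P + 0#                     ≈⟨ +-congˡ (zeroʳ a) ⟨
    head P + a * 0#                 ≈⟨ +-congˡ (*-congˡ (Q≈0 zero)) ⟨
    head P + a * eval (tail P) a    ≈⟨ eval-suc P a ⟨
    eval P a                        ≈⟨ root ⟩
    0#                              ∎
  quotient≈0⇒≈0 {suc m} a P root Q≈0 (suc i) =
    quotient≈0⇒≈0 a (tail P) (Q≈0 zero) (Q≈0 ∘ suc) i

  roots⇒≈0 : ∀ {m} (a P : Vector Carrier m) → Injective _≡_ _≈_ a →
             (∀ i → eval P (a i) ≈ 0#) → ∀ i → P i ≈ 0#
  roots⇒≈0 {suc m} a P a-inj roots = quotient≈0⇒≈0 (head a) P (roots zero)
    (roots⇒≈0 (tail a) (quotient (head a) P) (λ eq → Fin.suc-injective (a-inj eq)) Q-roots)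
    where
    a-a₀≉0 : ∀ i → ¬ (tail a i - head a ≈ 0#)
    a-a₀≉0 i eq with a-inj (x-y≈0⇒x≈y _ _ eq)
    ... | ()

    Q-roots : ∀ i → eval (quotient (head a) P) (tail a i) ≈ 0#
    Q-roots i = cancel (a-a₀≉0 i) (begin
      (tail a i - head a) * Qa                       ≈⟨ +-identityˡ _ ⟨
      0# + (tail a i - head a) * Qa                  ≈⟨ +-congʳ (roots zero) ⟨
      eval P (head a) + (tail a i - head a) * Qa     ≈⟨ eval-quotient (head a) P (tail a i) ⟨
      eval P (tail a i)                              ≈⟨ roots (suc i) ⟩
      0#                                             ∎)
      where
      Qa = eval (quotient (head a) P) (tail a i)

  element : Vector Carrier q
  element = Inverse.from enumeration

  element-injective : Injective _≡_ _≈_ element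
  element-injective {i} {j} eq =
    ≡.trans (≡.sym (Inverse.strictlyInverseˡ enumeration i))
      (≡.trans (Inverse.to-cong enumeration eq) (Inverse.strictlyInverseˡ enumeration j))

  element-surjective : ∀ x → element (Inverse.to enumeration x) ≈ x
  element-surjective = Inverse.strictlyInverseʳ enumeration

  eval-cong : ∀ {m} (P : Vector Carrier m) {x y} → x ≈ y → eval P x ≈ eval P y
  eval-cong {m} P x≈y = sum-cong-≋ {m} (λ i → *-congˡ {P i} (^-congˡ (toℕ i) x≈y))

  interpolation : (f : Func setoid setoid) →
                  ∃! _≋_ (λ (P : Vector Carrier q) → Interpolates f P)
  interpolation f = P , P-interpolates , unique
    where
    open Func f using (to; cong)

    P : Vector Carrier q
    P = proj₁ (interpolate element (to ∘ element) element-injective)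

    P-interpolates : Interpolates f P
    P-interpolates x = begin
      eval P x             ≈⟨ eval-cong P (element-surjective x) ⟨
      eval P (element i)   ≈⟨ proj₂ (interpolate element (to ∘ element) element-injective) i ⟩
      to (element i)       ≈⟨ cong (element-surjective x) ⟩
      to x                 ∎
      where
      i = Inverse.to enumeration x

    unique : ∀ {Q} → Interpolates f Q → P ≋ Q
    unique {Q} Q-interpolates i = x-y≈0⇒x≈y _ _
      (roots⇒≈0 element (λ j → P j - Q j) element-injective difference-vanishes i)
      where
      difference-vanishes : ∀ j → eval (λ i → P i - Q i) (element j) ≈ 0#
      difference-vanishes j = begin
        eval (λ i → P i - Q i) x             ≈⟨ eval-+ P (λ i → - Q i) x ⟩
        eval P x + eval (λ i → - Q i) x      ≈⟨ +-congˡ (eval-- Q x) ⟩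
        eval P x - eval Q x                  ≈⟨ x≈y⇒x-y≈0 (trans (P-interpolates x) (sym (Q-interpolates x))) ⟩
        0#                                   ∎
        where
        x = element j

  polynomial : Func setoid setoid → Vector Carrier q
  polynomial f = proj₁ (interpolation f)

  weight : Func setoid setoid → ℕ
  weight f = count (λ a → ¬? (a ≟ 0#)) (tabulate (polynomial f))

module Geometric where

  open import Data.Nat using (_+_; _*_)
  open import Data.Nat.Divisibility using (_∣_; _∣0; m∣m*n; ∣m∣n⇒∣m+n)
  open import Data.Nat.Properties using (*-distribʳ-+; *-identityˡ; +-∸-assoc; +-comm; m^n>0)

  -- The quotient ((m + 1) ^ e - 1) / m is exact, so truncated arithmetic on ℕ computes it.
  m∣[m+1]^e∸1 : ∀ m e → m ∣ (m + 1) ^ e ∸ 1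
  m∣[m+1]^e∸1 m zero    = m ∣0
  m∣[m+1]^e∸1 m (suc e) = ≡.subst (m ∣_) (≡.sym eq)
    (∣m∣n⇒∣m+n (m∣m*n a) (m∣[m+1]^e∸1 m e))
    where
    a = (m + 1) ^ e

    eq : (m + 1) * a ∸ 1 ≡ m * a + (a ∸ 1)
    eq = ≡.trans
      (≡.cong (_∸ 1) (≡.trans (*-distribʳ-+ a m 1) (≡.cong (m * a +_) (*-identityˡ a))))
      (+-∸-assoc (m * a) (m^n>0 (m + 1) {{≡.subst NonZero (+-comm 1 m) _}} e))

module AdditiveIndex {c ℓ : Level} (p n : ℕ) (F : FiniteField c ℓ (p ^ n)) where

  open FiniteField F
  open Algebra.Properties.Semiring.Mult semiring using () renaming (_×_ to _×ᶠ_)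
  open Algebra.Properties.Semiring.Sum semiring using (sum-syntax)

  -- When p is prime, a field with p ^ n elements has characteristic p, so the
  -- residues 0, …, p - 1 represent the prime field and act by iterated addition.
  infixr 7 _·_

  _·_ : Fin p → Carrier → Carrier
  a · x = toℕ a ×ᶠ x

  rawLeftModule : RawLeftModule (Fin p) c ℓ
  rawLeftModule = record
    { Carrierᴹ = Carrier
    ; _≈ᴹ_     = _≈_
    ; _+ᴹ_     = _+_
    ; _*ₗ_     = _·_
    ; 0ᴹ       = 0#
    ; -ᴹ_      = -_
    }

  open LeftModuleMorphisms rawLeftModule rawLeftModule public
    using () renaming (IsLeftModuleHomomorphism to IsLinear)

  linearCombination : ∀ {d} → Vector (Fin p) d → Vector Carrier d → Carrier
  linearCombination {d} a b = ∑[ i < d ] (a i · b i)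

  record IsSubspace (U : Pred Carrier ℓ) : Set (c ⊔ ℓ) where
    field
      respects : U Respects _≈_
      0-closed : 0# ∈ U
      +-closed : ∀ {x y} → x ∈ U → y ∈ U → (x + y) ∈ U
      ·-closed : ∀ a {x} → x ∈ U → (a · x) ∈ U

  record IsBasis (U : Pred Carrier ℓ) {d : ℕ} (b : Vector Carrier d) : Set (c ⊔ ℓ) where
    field
      members     : ∀ i → b i ∈ U
      independent : ∀ a → linearCombination a b ≈ 0# → ∀ i → toℕ (a i) ≡ 0
      spanning    : ∀ {x} → x ∈ U → ∃[ a ] linearCombination a b ≈ x

  HasDimension : Pred Carrier ℓ → ℕ → Set (c ⊔ ℓ)
  HasDimension U d = Σ[ b ∈ Vector Carrier d ] IsBasis U b

  ConstantOnCosets : Pred Carrier ℓ → (Carrier → Carrier) → Set (c ⊔ ℓ)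
  ConstantOnCosets U g = ∀ x {u v} → u ∈ U → v ∈ U → g (x + u) ≈ g (x + v)

  record CodimAtMost (f : Func setoid setoid) (k : ℕ) : Set (c ⊔ lsuc ℓ) where
    field
      k≤n       : k ≤ n
      M         : Carrier → Carrier
      linear    : IsLinear M
      U         : Pred Carrier ℓ
      subspace  : IsSubspace U
      dimension : HasDimension U (n ∸ k)
      constant  : ConstantOnCosets U (λ x → Func.to f x - M x)

  HasCodim : Func setoid setoid → ℕ → Set (c ⊔ lsuc ℓ)
  HasCodim f k = CodimAtMost f k × (∀ {j} → CodimAtMost f j → k ≤ j)

  HasAdditiveIndex : Func setoid setoid → ℕ → Set (c ⊔ lsuc ℓ)
  HasAdditiveIndex f m = ∃[ k ] (HasCodim f k × m ≡ p ^ k)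

{-# OPTIONS --safe #-}
module Submission where

-- Let g = f - M be constant on the cosets of U, with dim U = d = n - k. There is a linearised polynomial L
-- with exponents p ^ 0, …, p ^ d and kernel U: when U gains a basis vector b, replace L by T ^ p - T with
-- T = L / L(b). Then L takes at most p ^ k values, so g = h ∘ L with deg h < p ^ k. Expanding Lⁱ along the
-- base-p digits of i, each digit r contributes an r-fold sum of exponents of L, scaled by a power of p, so
-- at most 1 + (d + 1) + … + (d + 1) ^ (p - 1) exponents arise per digit. An additive map M is linearised
-- with exponents p ^ j, j < n, and for k ≥ 1 these already occur among the exponents of g.

open import Defs
open import Algebra.Bundles using (CommutativeSemiring)
import Algebra.Properties.AbelianGroup
import Algebra.Properties.CommutativeSemiring.Binomial
import Algebra.Properties.CommutativeSemiring.Exp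
import Algebra.Properties.Group
import Algebra.Properties.Monoid.Mult
import Algebra.Properties.Ring
import Algebra.Properties.Semiring.Mult
import Algebra.Properties.Semiring.Sum
import Algebra.Solver.Ring.NaturalCoefficients.Default
open import Data.Fin as Fin using (Fin; zero; suc; toℕ; fromℕ; fromℕ<; funToFin; finToFun)
import Data.Fin.Properties as Fin
open import Data.Fin.Permutation using (Permutation; permutation)
open import Data.List as List using (List; length; _++_)
import Data.List.Properties as List
import Data.List.Membership.Setoid.Properties as Membershipₛ
open import Data.List.Membership.Propositional using (_∈_)
open import Data.List.Membership.Propositional.Properties
  using (∈-map⁺; ∈-map⁻; ∈-filter⁺; ∈-lookup; ∈-++⁺ˡ; ∈-++⁺ʳ; ∈-++⁻; ∈-cartesianProductWith⁺; ∈-cartesianProductWith⁻;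
         ∈-applyUpTo⁺; ∈-applyUpTo⁻)
import Data.List.Relation.Unary.All as All
open import Data.List.Relation.Unary.Any as Any using (here; there)
open import Data.List.Relation.Unary.Any.Properties using (lookup-index)
open import Data.List.Relation.Unary.Unique.DecSetoid.Properties using (deduplicate-!)
open import Data.Nat as ℕ using (ℕ; zero; suc; _∸_; _^_; _/_; _%_; _≤_; _<_; z≤n; s≤s; NonZero; >-nonZero)
open import Data.Nat.Combinatorics using (_C_; nCn≡1; nCk≡n!/k![n-k]!; [n∸k]!k!∣n!)
open import Data.Nat.Coprimality using (prime⇒coprime; coprime-Bézout)
open import Data.Nat.DivMod using (m≡m%n+[m/n]*n; m%n<n; m<n*o⇒m/o<n)
open import Data.Nat.Divisibility using (_∣_; divides-refl; ∣-refl)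
open import Data.Nat.GCD using (module Bézout)
open import Data.Nat.Primality using (Prime; prime⇒nonTrivial; euclidsLemma)
import Data.Nat.Properties as ℕ
open import Data.Product using (_×_; _,_; proj₁; proj₂; Σ-syntax; ∃-syntax)
open import Data.Sum using (inj₁; inj₂)
open import Data.Vec using (count; tabulate)
open import Function using (Func; Inverse; _∘_; id)
open import Function.Definitions using (Injective)
open import Level using (Level; _⊔_)
open import Relation.Binary using (DecSetoid; Symmetric; tri<; tri≈; tri>)
import Relation.Binary.Construct.On as On
open import Relation.Binary.PropositionalEquality as ≡ using (_≡_; _≢_)
open import Relation.Nullary using (¬_; yes; no; contradiction; ¬?)
open import Relation.Unary using (Pred; Decidable)

-- Multiplying out `Lⁱ` directly would let the number of exponents grow with `i`, which can be as
-- large as `p ^ k - 1`. What prevents this is `L ^ (r + p j) = L ^ r * (L ^ j) ^ p`: a `p`-th power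
-- acts term by term and only rescales exponents by `p`, so honest products occur only inside a
-- single digit `r < p`. The bound is therefore a product of `k` equal factors, each the geometric
-- sum `((d + 1) ^ p - 1) / d`. The weight concerns the polynomial of degree below `q`, and
-- reduction modulo `x ^ q - x` could scramble exponents. None takes place: the largest exponent is
-- `(p ^ k - 1) * p ^ d`, which is below `p ^ n` because `k + d = n`. The field is given only as a
-- field with `p ^ n` elements. Its characteristic, a basis over the prime field and the number of
-- cosets of `U` all have to be extracted from counting.

module Combinatorics where

  open import Data.Fin using (combine)
  open import Data.List using ([]; _∷_; filter; map; applyUpTo; lookup; cartesianProductWith)
  open import Data.List.Properties using (length-map; length-filter; filter-notAll; length-++; length-applyUpTo)
  open import Data.List.Relation.Unary.AllPairs using (AllPairs; []; _∷_)
  open import Data.Nat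
  open import Data.Nat.Divisibility using (_∤_; ∣1⇒≡1; ∣⇒≤; m∣m*n)
  open import Data.Nat.DivMod using (m/n*n≡m; m*n/n≡m)
  open import Data.Nat.Properties
  open import Data.Nat.Solver using (module +-*-Solver)
  open import Relation.Binary.PropositionalEquality

  -- Binomial coefficients modulo a prime, and counting

  prime∤! : ∀ {p k} → Prime p → k < p → p ∤ k !
  prime∤! {k = zero}  p-prime k<p p∣k! = contradiction (∣1⇒≡1 p∣k!) (nonTrivial⇒≢1 {{prime⇒nonTrivial p-prime}})
  prime∤! {k = suc k} p-prime k<p p∣k! with euclidsLemma (suc k) (k !) p-prime p∣k!
  ... | inj₁ p∣1+k = <⇒≱ k<p (∣⇒≤ p∣1+k)
  ... | inj₂ p∣k!′ = prime∤! p-prime (<-trans (n<1+n k) k<p) p∣k!′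

  -- `p` divides `p !`, the product of `p C k` and `k ! * (p ∸ k) !`. Both factorials are products
  -- of numbers below `p`, so Euclid's lemma leaves only the binomial coefficient.
  prime∣C : ∀ {p k} → Prime p → 0 < k → k < p → p ∣ p C k
  prime∣C {p@(suc p-1)} {k} p-prime 0<k k<p
    with euclidsLemma (p C k) (k ! * (p ∸ k) !) p-prime (subst (p ∣_) (sym C*k![p∸k]!≡p!) (m∣m*n (p-1 !)))
    where
    instance _ = k !* (p ∸ k) !≢0
    C*k![p∸k]!≡p! : (p C k) * (k ! * (p ∸ k) !) ≡ p !
    C*k![p∸k]!≡p! = trans (cong (_* (k ! * (p ∸ k) !)) (nCk≡n!/k![n-k]! (<⇒≤ k<p)))
      (m/n*n≡m (subst (_∣ p !) (*-comm ((p ∸ k) !) (k !)) ([n∸k]!k!∣n! (<⇒≤ k<p))))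
  ... | inj₁ p∣C = p∣C
  ... | inj₂ p∣k![p∸k]! with euclidsLemma (k !) ((p ∸ k) !) p-prime p∣k![p∸k]!
  ...   | inj₁ p∣k! = contradiction p∣k! (prime∤! p-prime k<p)
  ...   | inj₂ p∣[p∸k]! = contradiction p∣[p∸k]! (prime∤! p-prime (∸-monoʳ-< 0<k (<⇒≤ k<p)))

  funToFin-cong : ∀ {m n} {f g : Fin m → Fin n} → (∀ i → f i ≡ g i) → funToFin f ≡ funToFin g
  funToFin-cong {zero}  f≗g = refl
  funToFin-cong {suc m} f≗g = cong₂ Fin.combine (f≗g zero) (funToFin-cong (f≗g ∘ suc))

  finToFun-injective : ∀ {m n} {i j : Fin (n ^ m)} → (∀ l → finToFun {n} {m} i l ≡ finToFun j l) → i ≡ j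
  finToFun-injective {m} {n} {i} {j} i≗j = begin
    i                                  ≡⟨ Fin.funToFin-finToFin {m} {n} i ⟨
    funToFin (finToFun {n} {m} i)      ≡⟨ funToFin-cong i≗j ⟩
    funToFin (finToFun {n} {m} j)      ≡⟨ Fin.funToFin-finToFin {m} {n} j ⟩
    j                                  ∎
    where open ≡-Reasoning

  length-cartesianProductWith : ∀ {a b c} {A : Set a} {B : Set b} {C : Set c} (f : A → B → C) xs ys →
                                length (cartesianProductWith f xs ys) ≡ length xs * length ys
  length-cartesianProductWith f []       ys = refl
  length-cartesianProductWith f (x ∷ xs) ys = trans (length-++ (map (f x) ys))
    (cong₂ _+_ (length-map (f x) ys) (length-cartesianProductWith f xs ys))

  -- Dropping index 0 shifts the remaining indices, so `E` is shifted by `pred`. A hit at index 0 is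
  -- paid for by deleting the zeros of `E`, which shortens it by at least one. Repetitions in `E` do
  -- no harm, so exponents may be listed as they arise.
  count≤length : ∀ {a p} {A : Set a} {P : Pred A p} (P? : Decidable P) {m} (f : Fin m → A) (E : List ℕ) →
                 (∀ i → P (f i) → toℕ i ∈ E) → count P? (tabulate f) ≤ length E
  count≤length P? {zero}  f E f∈E = z≤n
  count≤length P? {suc m} f E f∈E with P? (f zero)
  ... | no _  = ≤-trans (count≤length P? (f ∘ suc) (map pred E) λ i Pfi → ∈-map⁺ pred (f∈E (suc i) Pfi))
                  (≤-reflexive (length-map pred E))
  ... | yes Pf0 = begin
    suc (count P? (tabulate (f ∘ suc)))  ≤⟨ s≤s (count≤length P? (f ∘ suc) (map pred E⁺) λ i Pfi →
                                              ∈-map⁺ pred (∈-filter⁺ ≢0? (f∈E (suc i) Pfi) λ ())) ⟩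
    suc (length (map pred E⁺))           ≡⟨ cong suc (length-map pred E⁺) ⟩
    suc (length E⁺)                      ≤⟨ filter-notAll ≢0? E (Any.map (λ { refl 0≢0 → 0≢0 refl }) (f∈E zero Pf0)) ⟩
    length E                             ∎
    where
    open ≤-Reasoning
    ≢0? : Decidable (_≢ 0)
    ≢0? i = ¬? (i ≟ 0)
    E⁺ = filter ≢0? E

  lookup-injective : ∀ {a ℓ} {A : Set a} {_#_ : A → A → Set ℓ} {xs : List A} → Symmetric _#_ → AllPairs _#_ xs →
                     ∀ {i j} → ¬ (lookup xs i # lookup xs j) → i ≡ j
  lookup-injective #-sym (x# ∷ #xs) {zero}  {zero}  ¬# = refl
  lookup-injective #-sym (x# ∷ #xs) {zero}  {suc j} ¬# = contradiction (All.lookup x# (∈-lookup j)) ¬#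
  lookup-injective #-sym (x# ∷ #xs) {suc i} {zero}  ¬# = contradiction (#-sym (All.lookup x# (∈-lookup i))) ¬#
  lookup-injective #-sym (x# ∷ #xs) {suc i} {suc j} ¬# = cong suc (lookup-injective #-sym #xs ¬#)

  infixl 6 _⊕_

  _⊕_ : List ℕ → List ℕ → List ℕ
  _⊕_ = cartesianProductWith _+_

  -- Exponent lists: size, range and contents

  module Exponents (p : ℕ) where

    powers : ℕ → List ℕ
    powers = applyUpTo (p ^_)

    -- The sums of fewer than s powers p ^ j with j ≤ d.
    sums : ℕ → ℕ → List ℕ
    sums d zero    = []
    sums d (suc s) = 0 ∷ (powers (suc d) ⊕ sums d s)

    -- The exponents of the monomials in the powers Lⁱ, i < p ^ k, of a linearised polynomial L of degree p ^ d.
    exponents : ℕ → ℕ → List ℕ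
    exponents d zero    = 0 ∷ []
    exponents d (suc k) = sums d p ⊕ map (p *_) (exponents d k)

    -- Each step turns the length `l` into `1 + (d + 1) * l`, so this is the geometric series with
    -- ratio `d + 1`. Moving the 1 to the left keeps truncated subtraction out of the induction.
    length-sums : ∀ d s → length (sums d s) * d + 1 ≡ (d + 1) ^ s
    length-sums d zero    = refl
    length-sums d (suc s) = begin
      suc (length (powers (suc d) ⊕ sums d s)) * d + 1
        ≡⟨ cong (λ l → suc l * d + 1) (trans (length-cartesianProductWith _+_ (powers (suc d)) (sums d s))
                                        (cong (_* l) (length-applyUpTo (p ^_) (suc d)))) ⟩
      suc (suc d * l) * d + 1
        ≡⟨ solve 2 (λ d l → (con 1 :+ (con 1 :+ d) :* l) :* d :+ con 1 := (d :+ con 1) :* (l :* d :+ con 1)) refl d l ⟩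
      (d + 1) * (l * d + 1)
        ≡⟨ cong ((d + 1) *_) (length-sums d s) ⟩
      (d + 1) * (d + 1) ^ s ∎
      where
      open ≡-Reasoning
      open +-*-Solver
      l = length (sums d s)

    length-sums-/ : ∀ d s .{{_ : NonZero d}} → length (sums d s) ≡ ((d + 1) ^ s ∸ 1) / d
    length-sums-/ d s = begin
      l                        ≡⟨ m*n/n≡m l d ⟨
      l * d / d                ≡⟨ cong (_/ d) (m+n∸n≡m (l * d) 1) ⟨
      (l * d + 1 ∸ 1) / d      ≡⟨ cong (λ e → (e ∸ 1) / d) (length-sums d s) ⟩
      ((d + 1) ^ s ∸ 1) / d    ∎
      where
      open ≡-Reasoning
      l = length (sums d s)

    length-exponents : ∀ d k → length (exponents d k) ≡ length (sums d p) ^ k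
    length-exponents d zero    = refl
    length-exponents d (suc k) = trans (length-cartesianProductWith _+_ (sums d p) _)
      (cong (length (sums d p) *_) (trans (length-map (p *_) (exponents d k)) (length-exponents d k)))

    module _ (1<p : 1 < p) where

      private instance
        p≢0 : NonZero p
        p≢0 = >-nonZero (<-trans 0<1+n 1<p)

      powers-bound : ∀ {m e} → e ∈ powers m → e < p ^ m
      powers-bound e∈ with ∈-applyUpTo⁻ (p ^_) e∈
      ... | j , j<m , refl = ^-monoʳ-< p 1<p j<m

      sums-bound : ∀ d s {e} → e ∈ sums d s → e + p ^ d ≤ s * p ^ d
      sums-bound d (suc s) (here refl) = m≤m+n (p ^ d) (s * p ^ d)
      sums-bound d (suc s) (there e∈) with ∈-cartesianProductWith⁻ _+_ (powers (suc d)) (sums d s) e∈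
      ... | _ , e , a∈ , e∈sums , refl with ∈-applyUpTo⁻ (p ^_) a∈
      ... | j , j<1+d , refl = ≤-trans (≤-reflexive (+-assoc (p ^ j) e (p ^ d)))
        (+-mono-≤ (^-monoʳ-≤ p (s≤s⁻¹ j<1+d)) (sums-bound d s e∈sums))

      -- The maximum is `(p ^ k - 1) * p ^ d`. Stating it with the summand `p ^ d` lets that summand
      -- turn the digit bound for `a` into `p * p ^ d`, from which a factor `p` splits off.
      exponents-bound′ : ∀ d k {e} → e ∈ exponents d k → e + p ^ d ≤ p ^ k * p ^ d
      exponents-bound′ d zero    (here refl) = m≤m+n (p ^ d) 0
      exponents-bound′ d (suc k) e∈ with ∈-cartesianProductWith⁻ _+_ (sums d p) _ e∈
      ... | a , _ , a∈ , pe∈ , refl with ∈-map⁻ (p *_) pe∈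
      ... | e , e∈exponents , refl = begin
        a + p * e + p ^ d          ≡⟨ solve 3 (λ a e d → a :+ e :+ d := a :+ d :+ e) refl a (p * e) (p ^ d) ⟩
        a + p ^ d + p * e          ≤⟨ +-monoˡ-≤ (p * e) (sums-bound d p a∈) ⟩
        p * p ^ d + p * e          ≡⟨ solve 3 (λ p e d → p :* d :+ p :* e := p :* (e :+ d)) refl p e (p ^ d) ⟩
        p * (e + p ^ d)            ≤⟨ *-monoʳ-≤ p (exponents-bound′ d k e∈exponents) ⟩
        p * (p ^ k * p ^ d)        ≡⟨ *-assoc p (p ^ k) (p ^ d) ⟨
        p ^ suc k * p ^ d          ∎
        where
        open ≤-Reasoning
        open +-*-Solver

      exponents-bound : ∀ d k {e} → e ∈ exponents d k → e < p ^ (k + d)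
      exponents-bound d k {e} e∈ = begin-strict
        e                <⟨ m<m+n e (m^n>0 p d) ⟩
        e + p ^ d        ≤⟨ exponents-bound′ d k e∈ ⟩
        p ^ k * p ^ d    ≡⟨ ^-distribˡ-+-* p k d ⟨
        p ^ (k + d)      ∎
        where open ≤-Reasoning

      0∈sums : ∀ d {s} → 0 < s → 0 ∈ sums d s
      0∈sums d (s≤s _) = here refl

      0∈exponents : ∀ d k → 0 ∈ exponents d k
      0∈exponents d zero    = here refl
      0∈exponents d (suc k) = subst (_∈ exponents d (suc k)) (*-zeroʳ p)
        (∈-cartesianProductWith⁺ _+_ (0∈sums d (<-trans 0<1+n 1<p)) (∈-map⁺ (p *_) (0∈exponents d k)))

      power∈sums : ∀ d {j s} → j ≤ d → 1 < s → p ^ j ∈ sums d s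
      power∈sums d {j} j≤d (s≤s 0<s) = there (subst (_∈ _) (+-identityʳ (p ^ j))
        (∈-cartesianProductWith⁺ _+_ (∈-applyUpTo⁺ (p ^_) (s≤s j≤d)) (0∈sums d 0<s)))

      -- The lowest digit alone contains the powers up to `p ^ d`; every further digit brings a
      -- factor `p` and so one more power. One digit is the least that works, hence `suc k`.
      power∈exponents : ∀ d k j → j ≤ d + k → p ^ j ∈ exponents d (suc k)
      power∈exponents d k j j≤d+k with j ≤? d
      ... | yes j≤d = subst (_∈ exponents d (suc k)) (trans (cong (p ^ j +_) (*-zeroʳ p)) (+-identityʳ (p ^ j)))
        (∈-cartesianProductWith⁺ _+_ (power∈sums d j≤d 1<p) (∈-map⁺ (p *_) (0∈exponents d k)))
      power∈exponents d zero    j       j≤d+k | no j≰d = contradiction (subst (j ≤_) (+-identityʳ d) j≤d+k) j≰d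
      power∈exponents d (suc k) zero    j≤d+k | no j≰d = contradiction z≤n j≰d
      power∈exponents d (suc k) (suc j) j≤d+k | no j≰d =
        ∈-cartesianProductWith⁺ _+_ (0∈sums d (<-trans 0<1+n 1<p)) (∈-map⁺ (p *_)
          (power∈exponents d k j (s≤s⁻¹ (subst (suc j ≤_) (+-suc d k) j≤d+k))))

      powers⊆exponents : ∀ d k {e} → e ∈ powers (suc k + d) → e ∈ exponents d (suc k)
      powers⊆exponents d k e∈ with ∈-applyUpTo⁻ (p ^_) e∈
      ... | j , j<1+k+d , refl = power∈exponents d k j (subst (j ≤_) (+-comm k d) (s≤s⁻¹ j<1+k+d))

open Combinatorics

-- Polynomial functions with prescribed exponents

module Span {c ℓ : Level} (R : CommutativeSemiring c ℓ) where

  open CommutativeSemiring R hiding (zero)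
  open Algebra.Properties.CommutativeSemiring.Exp R using (^-congˡ; ^-homo-*) renaming (_^_ to _^ᶠ_)
  open Algebra.Properties.Semiring.Sum semiring using (sum-syntax)
  open Algebra.Solver.Ring.NaturalCoefficients.Default R using (solve; _:*_; _:=_)

  infixl 6 _+ˢ_

  -- The functions induced by the polynomials whose exponents all lie in E.
  data Span (E : List ℕ) : (Carrier → Carrier) → Set (c ⊔ ℓ) where
    monomial : ∀ a {e} → e ∈ E → Span E (λ x → a * x ^ᶠ e)
    0ˢ       : Span E (λ _ → 0#)
    _+ˢ_     : ∀ {φ ψ} → Span E φ → Span E ψ → Span E (λ x → φ x + ψ x)
    resp     : ∀ {φ ψ} → (∀ x → φ x ≈ ψ x) → Span E φ → Span E ψ

  Span-cong : ∀ {E φ} → Span E φ → ∀ {x y} → x ≈ y → φ x ≈ φ y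
  Span-cong (monomial a {e} e∈E) x≈y = *-congˡ (^-congˡ e x≈y)
  Span-cong 0ˢ                   x≈y = refl
  Span-cong (s +ˢ t)             x≈y = +-cong (Span-cong s x≈y) (Span-cong t x≈y)
  Span-cong (resp φ≈ψ s)         x≈y = trans (sym (φ≈ψ _)) (trans (Span-cong s x≈y) (φ≈ψ _))

  Span-⊆ : ∀ {E E′ φ} → (∀ {e} → e ∈ E → e ∈ E′) → Span E φ → Span E′ φ
  Span-⊆ E⊆E′ (monomial a e∈E) = monomial a (E⊆E′ e∈E)
  Span-⊆ E⊆E′ 0ˢ               = 0ˢ
  Span-⊆ E⊆E′ (s +ˢ t)         = Span-⊆ E⊆E′ s +ˢ Span-⊆ E⊆E′ t
  Span-⊆ E⊆E′ (resp φ≈ψ s)     = resp φ≈ψ (Span-⊆ E⊆E′ s)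

  power : ∀ {E e} → e ∈ E → Span E (_^ᶠ e)
  power e∈E = resp (λ x → *-identityˡ _) (monomial 1# e∈E)

  infixr 7 _*ˢ_

  _*ˢ_ : ∀ {E φ} a → Span E φ → Span E (λ x → a * φ x)
  a *ˢ monomial b e∈E = resp (λ x → *-assoc a b _) (monomial (a * b) e∈E)
  a *ˢ 0ˢ             = resp (λ x → sym (zeroʳ a)) 0ˢ
  a *ˢ (s +ˢ t)       = resp (λ x → sym (distribˡ a _ _)) (a *ˢ s +ˢ a *ˢ t)
  a *ˢ resp φ≈ψ s     = resp (λ x → *-congˡ (φ≈ψ x)) (a *ˢ s)

  Span-* : ∀ {E E′ φ ψ} → Span E φ → Span E′ ψ → Span (E ⊕ E′) (λ x → φ x * ψ x)
  Span-* (monomial a {e} e∈E) (monomial b {e′} e′∈E′) = resp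
    (λ x → trans (*-congˡ (^-homo-* x e e′))
      (solve 4 (λ a b y z → (a :* b) :* (y :* z) := (a :* y) :* (b :* z)) refl a b (x ^ᶠ e) (x ^ᶠ e′)))
    (monomial (a * b) (∈-cartesianProductWith⁺ ℕ._+_ e∈E e′∈E′))
  Span-* s@(monomial _ _) 0ˢ           = resp (λ x → sym (zeroʳ _)) 0ˢ
  Span-* s@(monomial _ _) (t +ˢ u)     = resp (λ x → sym (distribˡ _ _ _)) (Span-* s t +ˢ Span-* s u)
  Span-* s@(monomial _ _) (resp φ≈ψ t) = resp (λ x → *-congˡ (φ≈ψ x)) (Span-* s t)
  Span-* 0ˢ           t = resp (λ x → sym (zeroˡ _)) 0ˢ
  Span-* (s +ˢ u)     t = resp (λ x → sym (distribʳ _ _ _)) (Span-* s t +ˢ Span-* u t)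
  Span-* (resp φ≈ψ s) t = resp (λ x → *-congʳ (φ≈ψ x)) (Span-* s t)

  Span-sum : ∀ {E m} {φ : Fin m → Carrier → Carrier} → (∀ i → Span E (φ i)) → Span E (λ x → ∑[ i < m ] φ i x)
  Span-sum {m = zero}  s = 0ˢ
  Span-sum {m = suc m} s = s zero +ˢ Span-sum (s ∘ suc)

module Field {c ℓ : Level} (p n : ℕ) (p-prime : Prime p) (F : FiniteField c ℓ (p ^ n)) where

  open import Data.Vec.Functional using (Vector; []; _∷_; head; tail)
  open FiniteField F hiding (zero)
  open AdditiveIndex p n F
  open Weight F
  open Algebra.Properties.AbelianGroup +-abelianGroup using (xyx⁻¹≈y)
  open Algebra.Properties.CommutativeSemiring.Exp commutativeSemiring
    using (^-congˡ; ^-congʳ; ^-homo-*; ^-assocʳ; ^-distrib-*) renaming (_^_ to _^ᶠ_)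
  open Algebra.Properties.Group +-group using (∙-cancelˡ; identityʳ-unique; inverseʳ-unique)
    renaming (x≈y⇒x∙y⁻¹≈ε to x≈y⇒x-y≈0; x∙y⁻¹≈ε⇒x≈y to x-y≈0⇒x≈y)
  open Algebra.Properties.Ring ring using (-1*x≈-x)
  open Algebra.Properties.Semiring.Mult semiring
    using (×-congʳ; ×-congˡ; ×-homo-+; ×-homo-1; ×-assocˡ; ×-assoc-*; ×1-homo-*)
    renaming (_×_ to _×ᶠ_)
  open Algebra.Properties.Semiring.Sum semiring
    using (sum; sum-cong-≋; sum-permute; ∑-distrib-+; sum-replicate; sum-replicate-zero; sum-init-last; sum-syntax)
  open Algebra.Solver.Ring.NaturalCoefficients.Default commutativeSemiring
    using (solve; _:+_; _:*_; _:=_)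
  open import Relation.Binary.Reasoning.Setoid setoid
  open Span commutativeSemiring public
  open Exponents p public

  -- Characteristic and prime field

  1<p : 1 < p
  1<p = ℕ.nonTrivial⇒n>1 p {{prime⇒nonTrivial p-prime}}

  0<p : 0 < p
  0<p = ℕ.<-trans ℕ.0<1+n 1<p

  instance
    p-nonZero : NonZero p
    p-nonZero = >-nonZero 0<p

  -- Translation by 1 permutes F, so comparing the sums of all elements gives pⁿ × 1 = 0.
  |F|×1≈0 : (p ^ n) ×ᶠ 1# ≈ 0#
  |F|×1≈0 = identityʳ-unique (sum element) _ (begin
    sum element + (p ^ n) ×ᶠ 1#              ≈⟨ +-congˡ (sum-replicate (p ^ n)) ⟨
    sum element + sum {p ^ n} (λ _ → 1#)     ≈⟨ ∑-distrib-+ element (λ _ → 1#) ⟨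
    ∑[ i < p ^ n ] (element i + 1#)          ≈⟨ sum-cong-≋ {p ^ n} (λ i → element-surjective (element i + 1#)) ⟨
    sum (λ i → element (translate 1# i))     ≈⟨ sum-permute element translation ⟨
    sum element                              ∎)
    where
    translate : Carrier → Fin (p ^ n) → Fin (p ^ n)
    translate a i = Inverse.to enumeration (element i + a)

    translate-inverse : ∀ {a b} → a + b ≈ 0# → ∀ i → translate b (translate a i) ≡ i
    translate-inverse {a} {b} a+b≈0 i = element-injective (begin
      element (translate b (translate a i))    ≈⟨ element-surjective _ ⟩
      element (translate a i) + b              ≈⟨ +-congʳ (element-surjective _) ⟩
      (element i + a) + b                      ≈⟨ +-assoc (element i) a b ⟩
      element i + (a + b)                      ≈⟨ +-congˡ a+b≈0 ⟩
      element i + 0#                           ≈⟨ +-identityʳ (element i) ⟩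
      element i                                ∎)

    translation : Permutation (p ^ n) (p ^ n)
    translation = permutation (translate 1#) (translate (- 1#))
      (translate-inverse (-‿inverseˡ 1#)) (translate-inverse (-‿inverseʳ 1#))

  -- `(p ^ m) ×ᶠ 1#` is a product of `m` factors `p ×ᶠ 1#`. If that factor were nonzero, cancelling
  -- it repeatedly would end in `1# ≈ 0#`.
  p×1≈0 : p ×ᶠ 1# ≈ 0#
  p×1≈0 = root n |F|×1≈0
    where
    root : ∀ m → (p ^ m) ×ᶠ 1# ≈ 0# → p ×ᶠ 1# ≈ 0#
    root zero    1≈0 = contradiction (trans (sym 1≈0) (×-homo-1 1#)) 0≉1
    root (suc m) eq with p ×ᶠ 1# ≟ 0#
    ... | yes p×1≈0 = p×1≈0
    ... | no  p×1≉0 = root m (cancel p×1≉0 (trans (sym (×1-homo-* p (p ^ m))) eq))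

  ×≈×1* : ∀ m x → m ×ᶠ x ≈ (m ×ᶠ 1#) * x
  ×≈×1* m x = sym (trans (×-assoc-* m 1# x) (×-congʳ m (*-identityˡ x)))

  p∣m⇒m×x≈0 : ∀ {m} x → p ∣ m → m ×ᶠ x ≈ 0#
  p∣m⇒m×x≈0 x (divides-refl k) = begin
    (k ℕ.* p) ×ᶠ x               ≈⟨ ×-assocˡ x k p ⟨
    k ×ᶠ (p ×ᶠ x)                ≈⟨ ×≈×1* k _ ⟩
    (k ×ᶠ 1#) * (p ×ᶠ x)         ≈⟨ *-congˡ (trans (×≈×1* p x) (trans (*-congʳ p×1≈0) (zeroˡ x))) ⟩
    (k ×ᶠ 1#) * 0#               ≈⟨ zeroʳ _ ⟩
    0#                           ∎

  -- A nonzero `m < p` is coprime to `p`, so some multiples of `m` and of `p` differ by 1. Both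
  -- multiples annihilate `1#`, which forces `1# ≈ 0#`. The two cases tell which multiple is the
  -- larger, as Bézout coefficients are natural numbers here.
  m×1≈0⇒m≡0 : ∀ {m} → m < p → m ×ᶠ 1# ≈ 0# → m ≡ 0
  m×1≈0⇒m≡0 {zero}      m<p m×1≈0 = ≡.refl
  m×1≈0⇒m≡0 {m@(suc _)} m<p m×1≈0 with coprime-Bézout (prime⇒coprime p-prime m<p)
  ... | Bézout.+- x y 1+ym≡xp = contradiction (sym (begin
    1#                                  ≈⟨ +-identityʳ 1# ⟨
    1# + 0#                             ≈⟨ +-congˡ (trans (×1-homo-* y m) (trans (*-congˡ m×1≈0) (zeroʳ _))) ⟨
    1# + (y ℕ.* m) ×ᶠ 1#                ≡⟨⟩
    (1 ℕ.+ y ℕ.* m) ×ᶠ 1#               ≈⟨ ×-congˡ 1+ym≡xp ⟩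
    (x ℕ.* p) ×ᶠ 1#                     ≈⟨ p∣m⇒m×x≈0 1# (divides-refl x) ⟩
    0#                                  ∎)) 0≉1
  ... | Bézout.-+ x y 1+xp≡ym = contradiction (sym (begin
    1#                                  ≈⟨ +-identityʳ 1# ⟨
    1# + 0#                             ≈⟨ +-congˡ (p∣m⇒m×x≈0 1# (divides-refl x)) ⟨
    1# + (x ℕ.* p) ×ᶠ 1#                ≡⟨⟩
    (1 ℕ.+ x ℕ.* p) ×ᶠ 1#               ≈⟨ ×-congˡ 1+xp≡ym ⟩
    (y ℕ.* m) ×ᶠ 1#                     ≈⟨ trans (×1-homo-* y m) (trans (*-congˡ m×1≈0) (zeroʳ _)) ⟩
    0#                                  ∎)) 0≉1

  ⟦_⟧ : Fin p → Carrier
  ⟦ a ⟧ = toℕ a ×ᶠ 1#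

  ×1-injective-≤ : ∀ {l m} → l ≤ m → m < p → l ×ᶠ 1# ≈ m ×ᶠ 1# → l ≡ m
  ×1-injective-≤ {l} {m} l≤m m<p eq = ℕ.≤-antisym l≤m (ℕ.m∸n≡0⇒m≤n
    (m×1≈0⇒m≡0 (ℕ.≤-<-trans (ℕ.m∸n≤m m l) m<p) (identityʳ-unique (l ×ᶠ 1#) _ (begin
      l ×ᶠ 1# + (m ∸ l) ×ᶠ 1#     ≈⟨ ×-homo-+ 1# l (m ∸ l) ⟨
      (l ℕ.+ (m ∸ l)) ×ᶠ 1#       ≈⟨ ×-congˡ (ℕ.m+[n∸m]≡n l≤m) ⟩
      m ×ᶠ 1#                     ≈⟨ eq ⟨
      l ×ᶠ 1#                     ∎))))

  ⟦⟧-injective : Injective _≡_ _≈_ ⟦_⟧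
  ⟦⟧-injective {a} {b} eq with ℕ.≤-total (toℕ a) (toℕ b)
  ... | inj₁ a≤b = Fin.toℕ-injective (×1-injective-≤ a≤b (Fin.toℕ<n b) eq)
  ... | inj₂ b≤a = ≡.sym (Fin.toℕ-injective (×1-injective-≤ b≤a (Fin.toℕ<n a) (sym eq)))

  -- Additive maps and the Frobenius map

  record IsAdditive (φ : Carrier → Carrier) : Set (c ⊔ ℓ) where
    field
      cong   : ∀ {x y} → x ≈ y → φ x ≈ φ y
      +-homo : ∀ x y → φ (x + y) ≈ φ x + φ y

    0-homo : φ 0# ≈ 0#
    0-homo = identityʳ-unique (φ 0#) (φ 0#) (trans (sym (+-homo 0# 0#)) (cong (+-identityˡ 0#)))

    -- Prime-field scalars act by iterated addition, so an additive map is automatically linear over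
    -- the prime field.
    ×-homo : ∀ m x → φ (m ×ᶠ x) ≈ m ×ᶠ φ x
    ×-homo zero    x = 0-homo
    ×-homo (suc m) x = trans (+-homo x (m ×ᶠ x)) (+-congˡ (×-homo m x))

    -‿homo : ∀ x → φ (- x) ≈ - φ x
    -‿homo x = inverseʳ-unique (φ x) (φ (- x))
      (trans (sym (+-homo x (- x))) (trans (cong (-‿inverseʳ x)) 0-homo))

    ∸-homo : ∀ x y → φ (x - y) ≈ φ x - φ y
    ∸-homo x y = trans (+-homo x (- y)) (+-congˡ (-‿homo y))

  -- In characteristic `p`, `prime∣C` removes every term of the binomial expansion except the two at
  -- the ends.
  frobenius-+ : ∀ x y → (x + y) ^ᶠ p ≈ x ^ᶠ p + y ^ᶠ p
  frobenius-+ x y = frobenius-prime p p-prime 0<p p∣m⇒m×x≈0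
    where
    open Algebra.Properties.CommutativeSemiring.Binomial commutativeSemiring using (theorem; binomialTerm)

    -- p is a module parameter: the match exposing a predecessor needs a copy of it.
    frobenius-prime : ∀ r → Prime r → 0 < r → (∀ {m} z → r ∣ m → m ×ᶠ z ≈ 0#) → (x + y) ^ᶠ r ≈ x ^ᶠ r + y ^ᶠ r
    frobenius-prime r@(suc r-1) r-prime _ char = begin
      (x + y) ^ᶠ r                                ≈⟨ theorem r x y ⟩
      t zero + sum (t ∘ suc)                      ≈⟨ +-congˡ (sum-init-last (t ∘ suc)) ⟩
      t zero + (sum {r-1} (λ i → t (suc (Fin.inject₁ i))) + t (fromℕ r))
        ≈⟨ +-cong first (+-cong (trans (sum-cong-≋ {r-1} interior) (sum-replicate-zero r-1)) final) ⟩
      y ^ᶠ r + (0# + x ^ᶠ r)                      ≈⟨ trans (+-comm _ _) (+-congʳ (+-identityˡ _)) ⟩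
      x ^ᶠ r + y ^ᶠ r                             ∎
      where
      t = binomialTerm x y r

      interior : ∀ i → t (suc (Fin.inject₁ i)) ≈ 0#
      interior i = char _ (prime∣C r-prime ℕ.0<1+n (s≤s (≡.subst (_< r-1) (≡.sym (Fin.toℕ-inject₁ i)) (Fin.toℕ<n i))))

      first : t zero ≈ y ^ᶠ r
      first = trans (×-homo-1 _) (*-identityˡ _)

      final : t (fromℕ r) ≈ x ^ᶠ r
      final = top (Fin.toℕ-fromℕ r)
        where
        top : ∀ {k} → k ≡ r → (r C k) ×ᶠ (x ^ᶠ k * y ^ᶠ (r ∸ k)) ≈ x ^ᶠ r
        top ≡.refl = begin
          (r C r) ×ᶠ (x ^ᶠ r * y ^ᶠ (r ∸ r))    ≈⟨ ×-congˡ (nCn≡1 r) ⟩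
          1 ×ᶠ (x ^ᶠ r * y ^ᶠ (r ∸ r))          ≈⟨ ×-homo-1 _ ⟩
          x ^ᶠ r * y ^ᶠ (r ∸ r)                 ≈⟨ *-congˡ (^-congʳ y (ℕ.n∸n≡0 r)) ⟩
          x ^ᶠ r * 1#                           ≈⟨ *-identityʳ _ ⟩
          x ^ᶠ r                                ∎

  frobenius : IsAdditive (_^ᶠ p)
  frobenius = record { cong = ^-congˡ p ; +-homo = frobenius-+ }

  -- Fermat's little theorem: an additive map fixing `1#` fixes all its multiples. Powers are
  -- multiples in the multiplicative monoid, so `×-idem` says `1# ^ᶠ p ≈ 1#`.
  ⟦⟧-frobenius : ∀ a → ⟦ a ⟧ ^ᶠ p ≈ ⟦ a ⟧
  ⟦⟧-frobenius a = trans (IsAdditive.×-homo frobenius (toℕ a) 1#)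
    (×-congʳ (toℕ a) (Algebra.Properties.Monoid.Mult.×-idem *-monoid (*-identityˡ 1#) p))

  -- Monomials as coefficient vectors, and the fixed points of Frobenius

  unit : ∀ {m} → Fin m → Carrier → Vector Carrier m
  unit zero    a = a ∷ λ _ → 0#
  unit (suc i) a = 0# ∷ unit i a

  unit-≡ : ∀ {m} (i : Fin m) a → unit i a i ≈ a
  unit-≡ zero    a = refl
  unit-≡ (suc i) a = unit-≡ i a

  unit-≢ : ∀ {m} (i : Fin m) a {j} → i ≢ j → unit i a j ≈ 0#
  unit-≢ zero    a {zero}  i≢j = contradiction ≡.refl i≢j
  unit-≢ zero    a {suc j} i≢j = refl
  unit-≢ (suc i) a {zero}  i≢j = refl
  unit-≢ (suc i) a {suc j} i≢j = unit-≢ i a (i≢j ∘ ≡.cong suc)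

  eval-0 : ∀ m x → eval {m} (λ _ → 0#) x ≈ 0#
  eval-0 m x = trans (sum-cong-≋ {m} (λ i → zeroˡ _)) (sum-replicate-zero m)

  eval-unit : ∀ {m} (i : Fin m) a x → eval (unit i a) x ≈ a * x ^ᶠ toℕ i
  eval-unit {suc m} zero a x = begin
    eval {suc m} (unit zero a) x          ≈⟨ eval-suc {m} (unit zero a) x ⟩
    a + x * eval {m} (λ _ → 0#) x         ≈⟨ +-congˡ (trans (*-congˡ (eval-0 m x)) (zeroʳ x)) ⟩
    a + 0#                                ≈⟨ +-identityʳ a ⟩
    a                                     ≈⟨ *-identityʳ a ⟨
    a * 1#                                ∎
  eval-unit (suc i) a x = begin
    eval (unit (suc i) a) x         ≈⟨ eval-suc (unit (suc i) a) x ⟩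
    0# + x * eval (unit i a) x      ≈⟨ +-identityˡ _ ⟩
    x * eval (unit i a) x           ≈⟨ *-congˡ (eval-unit i a x) ⟩
    x * (a * x ^ᶠ toℕ i)            ≈⟨ solve 3 (λ x a y → x :* (a :* y) := a :* (x :* y)) refl x a (x ^ᶠ toℕ i) ⟩
    a * x ^ᶠ toℕ (suc i)            ∎

  -- Otherwise y and the p elements of the prime field are p + 1 roots of X ^ p - X.
  frobenius-fixed : ∀ {y} → y ^ᶠ p ≈ y → ∃[ a ] y ≈ ⟦ a ⟧
  frobenius-fixed {y} y^p≈y with Fin.any? (λ a → y ≟ ⟦ a ⟧)
  ... | yes found = found
  ... | no  ∉⟦⟧   = contradiction (trans (sym P≈0) P≈1) 0≉1
    where
    -- The index of exponent 1. It differs from the top index because `1 < p`, so the leading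
    -- coefficient of `P` remains 1.
    X : Fin (suc p)
    X = fromℕ< (s≤s 0<p)

    roots : Vector Carrier (suc p)
    roots = y ∷ ⟦_⟧

    roots-injective : Injective _≡_ _≈_ roots
    roots-injective {zero}  {zero}  eq = ≡.refl
    roots-injective {zero}  {suc j} eq = contradiction (j , eq) ∉⟦⟧
    roots-injective {suc i} {zero}  eq = contradiction (i , sym eq) ∉⟦⟧
    roots-injective {suc i} {suc j} eq = ≡.cong suc (⟦⟧-injective eq)

    roots-fixed : ∀ i → roots i ^ᶠ p ≈ roots i
    roots-fixed zero    = y^p≈y
    roots-fixed (suc a) = ⟦⟧-frobenius a

    P : Vector Carrier (suc p)
    P i = unit (fromℕ p) 1# i + unit X (- 1#) i

    eval-P : ∀ x → eval P x ≈ x ^ᶠ p - x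
    eval-P x = begin
      eval P x                                                  ≈⟨ eval-+ (unit (fromℕ p) 1#) (unit X (- 1#)) x ⟩
      eval (unit (fromℕ p) 1#) x + eval (unit X (- 1#)) x        ≈⟨ +-cong (eval-unit (fromℕ p) 1# x) (eval-unit X (- 1#) x) ⟩
      1# * x ^ᶠ toℕ (fromℕ p) + - 1# * x ^ᶠ toℕ X
        ≈⟨ +-cong (trans (*-identityˡ _) (^-congʳ x (Fin.toℕ-fromℕ p)))
                  (trans (-1*x≈-x _) (-‿cong (trans (^-congʳ x (Fin.toℕ-fromℕ< (s≤s 0<p))) (*-identityʳ x)))) ⟩
      x ^ᶠ p - x                                                ∎

    P≈0 : P (fromℕ p) ≈ 0#
    P≈0 = roots⇒≈0 roots P roots-injective
      (λ i → trans (eval-P (roots i)) (x≈y⇒x-y≈0 (roots-fixed i))) (fromℕ p)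

    X≢p : X ≢ fromℕ p
    X≢p X≡p = ℕ.<⇒≢ 1<p (≡.trans (≡.sym (Fin.toℕ-fromℕ< (s≤s 0<p))) (≡.trans (≡.cong toℕ X≡p) (Fin.toℕ-fromℕ p)))

    P≈1 : P (fromℕ p) ≈ 1#
    P≈1 = trans (+-cong (unit-≡ (fromℕ p) 1#) (unit-≢ X (- 1#) X≢p)) (+-identityʳ 1#)

  -- Additivity of Frobenius makes the list of exponents no longer than before, unlike a `p`-fold
  -- use of `Span-*`. The length bound depends on this.
  Span-frobenius : ∀ {E φ} → Span E φ → Span (List.map (p ℕ.*_) E) (λ x → φ x ^ᶠ p)
  Span-frobenius (monomial a {e} e∈E) = resp
    (λ x → begin
      a ^ᶠ p * x ^ᶠ (p ℕ.* e)      ≈⟨ *-congˡ (^-congʳ x (ℕ.*-comm p e)) ⟩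
      a ^ᶠ p * x ^ᶠ (e ℕ.* p)      ≈⟨ *-congˡ (^-assocʳ x e p) ⟨
      a ^ᶠ p * (x ^ᶠ e) ^ᶠ p       ≈⟨ ^-distrib-* a (x ^ᶠ e) p ⟨
      (a * x ^ᶠ e) ^ᶠ p            ∎)
    (monomial (a ^ᶠ p) (∈-map⁺ (p ℕ.*_) e∈E))
  Span-frobenius 0ˢ           = resp (λ x → sym (IsAdditive.0-homo frobenius)) 0ˢ
  Span-frobenius (s +ˢ t)     = resp (λ x → sym (frobenius-+ _ _)) (Span-frobenius s +ˢ Span-frobenius t)
  Span-frobenius (resp φ≈ψ s) = resp (λ x → ^-congˡ p (φ≈ψ x)) (Span-frobenius s)

  -- Linearised polynomials

  powers-⊆ : ∀ {l m} → l ≤ m → ∀ {e} → e ∈ powers l → e ∈ powers m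
  powers-⊆ l≤m e∈ with ∈-applyUpTo⁻ (p ^_) e∈
  ... | j , j<l , ≡.refl = ∈-applyUpTo⁺ (p ^_) (ℕ.<-≤-trans j<l l≤m)

  linearised-frobenius : ∀ {m φ} → Span (powers m) φ → Span (powers (suc m)) (λ x → φ x ^ᶠ p)
  linearised-frobenius {m} = Span-⊆ p*powers⊆powers ∘ Span-frobenius
    where
    p*powers⊆powers : ∀ {e} → e ∈ List.map (p ℕ.*_) (powers m) → e ∈ powers (suc m)
    p*powers⊆powers pe∈ with ∈-map⁻ (p ℕ.*_) pe∈
    ... | e , e∈ , ≡.refl with ∈-applyUpTo⁻ (p ^_) e∈
    ... | j , j<m , ≡.refl = ∈-applyUpTo⁺ (p ^_) (s≤s j<m)

  linearised-additive : ∀ {m φ} → Span (powers m) φ → IsAdditive φ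
  linearised-additive {m} s = record { cong = Span-cong s ; +-homo = homo s }
    where
    ^p^-+ : ∀ j x y → (x + y) ^ᶠ (p ^ j) ≈ x ^ᶠ (p ^ j) + y ^ᶠ (p ^ j)
    ^p^-+ zero    x y = distribʳ 1# x y
    ^p^-+ (suc j) x y = begin
      (x + y) ^ᶠ (p ^ suc j)                        ≈⟨ ^-assocʳ (x + y) p (p ^ j) ⟨
      ((x + y) ^ᶠ p) ^ᶠ (p ^ j)                     ≈⟨ ^-congˡ (p ^ j) (frobenius-+ x y) ⟩
      (x ^ᶠ p + y ^ᶠ p) ^ᶠ (p ^ j)                  ≈⟨ ^p^-+ j (x ^ᶠ p) (y ^ᶠ p) ⟩
      (x ^ᶠ p) ^ᶠ (p ^ j) + (y ^ᶠ p) ^ᶠ (p ^ j)     ≈⟨ +-cong (^-assocʳ x p (p ^ j)) (^-assocʳ y p (p ^ j)) ⟩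
      x ^ᶠ (p ^ suc j) + y ^ᶠ (p ^ suc j)           ∎

    homo : ∀ {φ} → Span (powers m) φ → ∀ x y → φ (x + y) ≈ φ x + φ y
    homo (monomial a e∈) x y with ∈-applyUpTo⁻ (p ^_) e∈
    ... | j , _ , ≡.refl = trans (*-congˡ (^p^-+ j x y)) (distribˡ a _ _)
    homo 0ˢ           x y = sym (+-identityˡ 0#)
    homo (s +ˢ t)     x y = trans (+-cong (homo s x y) (homo t x y))
      (solve 4 (λ a b c d → (a :+ b) :+ (c :+ d) := (a :+ c) :+ (b :+ d)) refl _ _ _ _)
    homo (resp φ≈ψ s) x y = trans (sym (φ≈ψ _)) (trans (homo s x y) (+-cong (φ≈ψ x) (φ≈ψ y)))

  -- Independent families and the polynomials that annihilate them

  Independent : ∀ {d} → Vector Carrier d → Set ℓ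
  Independent b = ∀ a → linearCombination a b ≈ 0# → ∀ i → toℕ (a i) ≡ 0

  ·≈⟦⟧* : ∀ a x → a · x ≈ ⟦ a ⟧ * x
  ·≈⟦⟧* a x = ×≈×1* (toℕ a) x

  ·-homo : ∀ {φ} → IsAdditive φ → ∀ a x → φ (a · x) ≈ ⟦ a ⟧ * φ x
  ·-homo φ-additive a x = trans (IsAdditive.×-homo φ-additive (toℕ a) x) (·≈⟦⟧* a _)

  0·x≈0 : ∀ {a} x → toℕ a ≡ 0 → a · x ≈ 0#
  0·x≈0 x a≡0 = ×-congˡ a≡0

  independent-tail : ∀ {d} {b : Vector Carrier (suc d)} → Independent b → Independent (tail b)
  independent-tail {b = b} b-indep a eq i = b-indep (fromℕ< 0<p ∷ a)
    (trans (+-cong (0·x≈0 (head b) (Fin.toℕ-fromℕ< 0<p)) eq) (+-identityˡ 0#)) (suc i)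

  -- Otherwise (p - 1) b₀ + b₀ = 0 is a nontrivial relation.
  head∉span : ∀ {d} {b : Vector Carrier (suc d)} → Independent b → ∀ a → ¬ (linearCombination a (tail b) ≈ head b)
  head∉span {b = b} b-indep a a∙b≈b₀ = ℕ.<⇒≢ (ℕ.m<n⇒0<n∸m 1<p)
    (≡.sym (≡.trans (≡.sym toℕ≡p-1) (b-indep (fromℕ< p-1<p ∷ a) relation zero)))
    where
    p-1<p : p ∸ 1 < p
    p-1<p = ℕ.∸-monoʳ-< (s≤s z≤n) 0<p

    toℕ≡p-1 : toℕ (fromℕ< p-1<p) ≡ p ∸ 1
    toℕ≡p-1 = Fin.toℕ-fromℕ< p-1<p

    relation : linearCombination (fromℕ< p-1<p ∷ a) b ≈ 0#
    relation = begin
      fromℕ< p-1<p · head b + linearCombination a (tail b)     ≈⟨ +-cong (×-congˡ toℕ≡p-1) a∙b≈b₀ ⟩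
      (p ∸ 1) ×ᶠ head b + head b                               ≈⟨ +-comm _ _ ⟩
      (1 ℕ.+ (p ∸ 1)) ×ᶠ head b                                ≈⟨ ×-congˡ (ℕ.m+[n∸m]≡n 0<p) ⟩
      p ×ᶠ head b                                              ≈⟨ p∣m⇒m×x≈0 (head b) ∣-refl ⟩
      0#                                                       ∎

  -- For independent `b` this is, up to a nonzero scalar, the subspace polynomial: the product of
  -- `x - u` over all `u` in the span of `b`. It makes membership in the span decidable, by testing
  -- `L x ≈ 0#`.
  record Annihilator {d} (b : Vector Carrier d) : Set (c ⊔ ℓ) where
    field
      L          : Carrier → Carrier
      linearised : Span (powers (suc d)) L
      vanishes   : ∀ a → L (linearCombination a b) ≈ 0#
      kernel     : ∀ {x} → L x ≈ 0# → ∃[ a ] linearCombination a b ≈ x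

    additive : IsAdditive L
    additive = linearised-additive linearised

    open IsAdditive additive public

  -- On the span of `b`, `T` is the first coordinate, read as a prime-field element, because `A.L`
  -- kills the other basis vectors. This one functional enlarges annihilators, shows that
  -- coordinates are unique, and serves as the new element in Newton interpolation.
  module Coordinate {d : ℕ} {b : Vector Carrier (suc d)} (b-indep : Independent b) (A : Annihilator (tail b)) where

    private module A = Annihilator A

    L[b₀]≉0 : ¬ (A.L (head b) ≈ 0#)
    L[b₀]≉0 eq with A.kernel eq
    ... | a , a∙b≈b₀ = head∉span {b = b} b-indep a a∙b≈b₀

    L[b₀]⁻¹ : Carrier
    L[b₀]⁻¹ = proj₁ (invertible L[b₀]≉0)

    T : Carrier → Carrier
    T x = L[b₀]⁻¹ * A.L x

    T-linearised : Span (powers (suc d)) T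
    T-linearised = L[b₀]⁻¹ *ˢ A.linearised

    T-additive : IsAdditive T
    T-additive = linearised-additive T-linearised

    T-head : ∀ a → T (a · head b) ≈ ⟦ a ⟧
    T-head a = trans (·-homo T-additive a (head b))
      (trans (*-congˡ (proj₁ (proj₂ (invertible L[b₀]≉0)))) (*-identityʳ ⟦ a ⟧))

    T-linearCombination : ∀ a → T (linearCombination a b) ≈ ⟦ head a ⟧
    T-linearCombination a = begin
      T (head a · head b + linearCombination (tail a) (tail b))      ≈⟨ IsAdditive.+-homo T-additive _ _ ⟩
      T (head a · head b) + T (linearCombination (tail a) (tail b))
        ≈⟨ +-cong (T-head (head a)) (trans (*-congˡ (A.vanishes (tail a))) (zeroʳ _)) ⟩
      ⟦ head a ⟧ + 0#                                               ≈⟨ +-identityʳ _ ⟩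
      ⟦ head a ⟧                                                    ∎

    T-kernel : ∀ {x} → T x ≈ 0# → A.L x ≈ 0#
    T-kernel {x} Tx≈0 = begin
      A.L x                                   ≈⟨ *-identityˡ _ ⟨
      1# * A.L x                              ≈⟨ *-congʳ (proj₂ (proj₂ (invertible L[b₀]≉0))) ⟨
      (A.L (head b) * L[b₀]⁻¹) * A.L x        ≈⟨ *-assoc _ _ _ ⟩
      A.L (head b) * T x                      ≈⟨ *-congˡ Tx≈0 ⟩
      A.L (head b) * 0#                       ≈⟨ zeroʳ _ ⟩
      0#                                      ∎

    T-spanned : ∀ {x} a → T x ≈ ⟦ a ⟧ → ∃[ a′ ] linearCombination a′ b ≈ x
    T-spanned {x} a Tx≈a with A.kernel (T-kernel (begin
      T (x - a · head b)         ≈⟨ IsAdditive.∸-homo T-additive x _ ⟩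
      T x - T (a · head b)       ≈⟨ x≈y⇒x-y≈0 (trans Tx≈a (sym (T-head a))) ⟩
      0#                         ∎))
    ... | a′ , a′∙b≈x-a·b₀ = (a ∷ a′) , (begin
      a · head b + linearCombination a′ (tail b)      ≈⟨ +-congˡ a′∙b≈x-a·b₀ ⟩
      a · head b + (x - a · head b)                   ≈⟨ +-assoc _ _ _ ⟨
      a · head b + x - a · head b                     ≈⟨ xyx⁻¹≈y _ x ⟩
      x                                               ∎)

  -- `T x ^ᶠ p - T x` vanishes exactly when `T x` is some `⟦ a ⟧`; then `T` kills `x - a · head b`,
  -- which therefore lies in the span of the tail. For the empty family, `L` is the identity,
  -- written as the power `p ^ 0`.
  annihilator : ∀ {d} {b : Vector Carrier d} → Independent b → Annihilator b
  annihilator {zero} {b} _ = record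
    { L          = _^ᶠ (p ^ 0)
    ; linearised = power (∈-applyUpTo⁺ (p ^_) ℕ.0<1+n)
    ; vanishes   = λ _ → *-identityʳ 0#
    ; kernel     = λ x^1≈0 → [] , trans (sym x^1≈0) (*-identityʳ _)
    }
  annihilator {suc d} {b} b-indep = record
    { L          = λ x → T x ^ᶠ p - T x
    ; linearised = linearised-frobenius T-linearised
                   +ˢ resp (λ x → -1*x≈-x (T x)) (- 1# *ˢ Span-⊆ (powers-⊆ (ℕ.n≤1+n (suc d))) T-linearised)
    ; vanishes   = λ a → x≈y⇒x-y≈0 (begin
        T (linearCombination a b) ^ᶠ p      ≈⟨ ^-congˡ p (T-linearCombination a) ⟩
        ⟦ head a ⟧ ^ᶠ p                     ≈⟨ ⟦⟧-frobenius (head a) ⟩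
        ⟦ head a ⟧                          ≈⟨ T-linearCombination a ⟨
        T (linearCombination a b)           ∎)
    ; kernel     = λ eq → let a , Tx≈a = frobenius-fixed (x-y≈0⇒x≈y _ _ eq) in T-spanned a Tx≈a
    }
    where open Coordinate {b = b} b-indep (annihilator (independent-tail {b = b} b-indep))

  linearCombination-injective : ∀ {d} {b : Vector Carrier d} → Independent b → ∀ {a a′} →
                                linearCombination a b ≈ linearCombination a′ b → ∀ i → a i ≡ a′ i
  linearCombination-injective {suc d} {b} b-indep {a} {a′} eq = λ where
      zero    → a₀≡a′₀
      (suc i) → linearCombination-injective (independent-tail {b = b} b-indep) {tail a} {tail a′}
                  (∙-cancelˡ (head a · head b) _ _ (trans eq (+-congʳ (×-congˡ (≡.cong toℕ (≡.sym a₀≡a′₀)))))) i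
    where
    open Coordinate {b = b} b-indep (annihilator (independent-tail {b = b} b-indep))
    a₀≡a′₀ : head a ≡ head a′
    a₀≡a′₀ = ⟦⟧-injective (trans (sym (T-linearCombination a))
      (trans (IsAdditive.cong T-additive eq) (T-linearCombination a′)))

  -- Applying `L` to a relation erases its part in the span of `b` and leaves `⟦ head a ⟧ * L x`, so
  -- the new coefficient must vanish.
  independent-∷ : ∀ {d} {b : Vector Carrier d} (A : Annihilator b) → Independent b →
                  ∀ {x} → ¬ (Annihilator.L A x ≈ 0#) → Independent (x ∷ b)
  independent-∷ {b = b} A b-indep {x} Lx≉0 a eq = λ where
      zero    → a₀≡0
      (suc i) → b-indep (tail a) (trans (sym (trans (+-congʳ (0·x≈0 x a₀≡0)) (+-identityˡ _))) eq) i
    where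
    open Annihilator A
    a₀≡0 : toℕ (head a) ≡ 0
    a₀≡0 = m×1≈0⇒m≡0 (Fin.toℕ<n (head a)) (cancel Lx≉0 (begin
      L x * ⟦ head a ⟧                                      ≈⟨ *-comm _ _ ⟩
      ⟦ head a ⟧ * L x                                      ≈⟨ ·-homo additive (head a) x ⟨
      L (head a · x)                                        ≈⟨ +-identityʳ _ ⟨
      L (head a · x) + 0#                                   ≈⟨ +-congˡ (vanishes (tail a)) ⟨
      L (head a · x) + L (linearCombination (tail a) b)     ≈⟨ +-homo _ _ ⟨
      L (linearCombination a (x ∷ b))                       ≈⟨ cong eq ⟩
      L 0#                                                  ≈⟨ 0-homo ⟩
      0#                                                    ∎))

  -- Dimension by counting

  index : Carrier → Fin (p ^ n)
  index = Inverse.to enumeration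

  index-injective : ∀ {x y} → index x ≡ index y → x ≈ y
  index-injective {x} {y} eq = trans (sym (element-surjective x)) (trans (reflexive (≡.cong element eq)) (element-surjective y))

  independent⇒≤ : ∀ {d} {b : Vector Carrier d} → Independent b → p ^ d ≤ p ^ n
  independent⇒≤ {d} {b} b-indep = Fin.injective⇒≤
    {f = λ i → index (linearCombination (finToFun {p} {d} i) b)}
    (λ eq → finToFun-injective {d} {p} (linearCombination-injective {b = b} b-indep (index-injective eq)))

  -- If `L` vanished everywhere, coordinates with respect to `b` would inject the `p ^ n` elements
  -- into `p ^ d` tuples. Since the field is enumerated, failure of the universal statement yields
  -- an actual witness.
  outside-span : ∀ {d} {b : Vector Carrier d} (A : Annihilator b) → d < n → ∃[ x ] ¬ (Annihilator.L A x ≈ 0#)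
  outside-span {d} {b} A d<n with Fin.¬∀⟶∃¬ (p ^ n) _ (λ i → L (element i) ≟ 0#) L∘element≉0
    where
    open Annihilator A
    L∘element≉0 : ¬ (∀ i → L (element i) ≈ 0#)
    L∘element≉0 L≈0 = ℕ.<⇒≱ (ℕ.^-monoʳ-< p 1<p d<n) (Fin.injective⇒≤ {f = λ i → funToFin (coordinates i)} λ {i} {j} eq →
      element-injective (begin
        element i                              ≈⟨ proj₂ (kernel (L≈0 i)) ⟨
        linearCombination (coordinates i) b
          ≈⟨ sum-cong-≋ {d} (λ l → ×-congˡ (≡.cong toℕ (coordinates-≡ i j eq l))) ⟩
        linearCombination (coordinates j) b    ≈⟨ proj₂ (kernel (L≈0 j)) ⟩
        element j                              ∎))
      where
      coordinates : Fin (p ^ n) → Fin d → Fin p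
      coordinates i = proj₁ (kernel (L≈0 i))

      coordinates-≡ : ∀ i j → funToFin (coordinates i) ≡ funToFin (coordinates j) →
                      ∀ l → coordinates i l ≡ coordinates j l
      coordinates-≡ i j eq l = ≡.trans (≡.sym (Fin.finToFun-funToFin (coordinates i) l))
        (≡.trans (≡.cong (λ k → finToFun k l) eq) (Fin.finToFun-funToFin (coordinates j) l))
  ... | i , Li≉0 = element i , Li≉0

  ∃-independent : ∀ d → d ≤ n → Σ[ b ∈ Vector Carrier d ] Independent b
  ∃-independent zero    _   = [] , λ _ _ ()
  ∃-independent (suc d) d<n with ∃-independent d (ℕ.<⇒≤ d<n)
  ... | b , b-indep with outside-span (annihilator b-indep) d<n
  ... | x , Lx≉0 = x ∷ b , independent-∷ (annihilator b-indep) b-indep Lx≉0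

  -- A vector outside the span would extend `b` to `n + 1` independent vectors, hence to
  -- `p ^ (n + 1)` distinct combinations.
  independent⇒spanning : {b : Vector Carrier n} → Independent b → ∀ x → ∃[ a ] linearCombination a b ≈ x
  independent⇒spanning {b} b-indep x with Annihilator.L A x ≟ 0#
    where A = annihilator b-indep
  ... | yes Lx≈0 = Annihilator.kernel (annihilator b-indep) Lx≈0
  ... | no  Lx≉0 = contradiction (independent⇒≤ {b = x ∷ b} (independent-∷ (annihilator b-indep) b-indep Lx≉0))
    (ℕ.<⇒≱ (ℕ.^-monoʳ-< p 1<p (ℕ.n<1+n n)))

  -- Additive maps as linearised polynomials

  -- Newton interpolation: T vanishes on the earlier basis vectors and is 1 at the new one.
  interpolate-linearised : ∀ {M} → IsAdditive M → ∀ {d} {b : Vector Carrier d} → Independent b →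
    Σ[ N ∈ (Carrier → Carrier) ] Span (powers d) N × (∀ a → N (linearCombination a b) ≈ M (linearCombination a b))
  interpolate-linearised M-additive {zero} b-indep = (λ _ → 0#) , 0ˢ , λ _ → sym (IsAdditive.0-homo M-additive)
  interpolate-linearised {M} M-additive {suc d} {b} b-indep with interpolate-linearised M-additive (independent-tail {b = b} b-indep)
  ... | N , N-span , N≈M = (λ x → N x + δ * T x) , Span-⊆ (powers-⊆ (ℕ.n≤1+n d)) N-span +ˢ δ *ˢ T-linearised , λ a → begin
    N (linearCombination a b) + δ * T (linearCombination a b)
      ≈⟨ +-cong (IsAdditive.+-homo N-additive _ _) (*-congˡ (T-linearCombination a)) ⟩
    (N (head a · b₀) + N (linearCombination (tail a) (tail b))) + δ * ⟦ head a ⟧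
      ≈⟨ +-congʳ (+-cong (·-homo N-additive (head a) b₀) (N≈M (tail a))) ⟩
    (⟦ head a ⟧ * N b₀ + M (linearCombination (tail a) (tail b))) + δ * ⟦ head a ⟧
      ≈⟨ solve 5 (λ a N m M N⁻ → (a :* N :+ m) :+ (M :+ N⁻) :* a := a :* (N :+ M :+ N⁻) :+ m)
           refl ⟦ head a ⟧ (N b₀) _ (M b₀) (- N b₀) ⟩
    ⟦ head a ⟧ * (N b₀ + M b₀ - N b₀) + M (linearCombination (tail a) (tail b))
      ≈⟨ +-congʳ (*-congˡ (xyx⁻¹≈y (N b₀) (M b₀))) ⟩
    ⟦ head a ⟧ * M b₀ + M (linearCombination (tail a) (tail b))
      ≈⟨ +-congʳ (·-homo M-additive (head a) b₀) ⟨
    M (head a · b₀) + M (linearCombination (tail a) (tail b))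
      ≈⟨ IsAdditive.+-homo M-additive _ _ ⟨
    M (linearCombination a b) ∎
    where
    open Coordinate {b = b} b-indep (annihilator (independent-tail {b = b} b-indep))
    b₀ = head b
    δ  = M b₀ - N b₀
    N-additive = linearised-additive N-span

  -- Interpolation spends one exponent per basis vector, so a basis of the whole field uses only
  -- `p ^ j` with `j < n`.
  additive⇒linearised : ∀ {M} → IsAdditive M → Span (powers n) M
  additive⇒linearised {M} M-additive with ∃-independent n ℕ.≤-refl
  ... | b , b-indep with interpolate-linearised M-additive b-indep
  ... | N , N-span , N≈M = resp N≈M′ N-span
    where
    N≈M′ : ∀ x → N x ≈ M x
    N≈M′ x with independent⇒spanning b-indep x
    ... | a , a∙b≈x = trans (Span-cong N-span (sym a∙b≈x)) (trans (N≈M a) (IsAdditive.cong M-additive a∙b≈x))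

  -- Powers of a linearised polynomial, and factoring a periodic map through one

  power-sums : ∀ {d φ r s} → Span (powers (suc d)) φ → r < s → Span (sums d s) (λ x → φ x ^ᶠ r)
  power-sums {r = zero}  φ-span (s≤s _)   = power (here ≡.refl)
  -- `sums d s` keeps all shorter sums as well, so one list serves every digit; `there` steps over
  -- the empty sum.
  power-sums {r = suc r} φ-span (s≤s r<s) = Span-⊆ there (Span-* φ-span (power-sums φ-span r<s))

  -- Writing i = r + p j, the power φ ^ i is φ ^ r times the Frobenius image of φ ^ j.
  power-exponents : ∀ {d φ} k {i} → Span (powers (suc d)) φ → i < p ^ k → Span (exponents d k) (λ x → φ x ^ᶠ i)
  power-exponents zero    {zero} φ-span _ = power (here ≡.refl)
  power-exponents zero    {suc i} φ-span (s≤s ())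
  power-exponents {φ = φ} (suc k) {i} φ-span i<p^1+k = resp
    (λ x → begin
      φ x ^ᶠ (i % p) * (φ x ^ᶠ (i / p)) ^ᶠ p        ≈⟨ *-congˡ (^-assocʳ (φ x) (i / p) p) ⟩
      φ x ^ᶠ (i % p) * φ x ^ᶠ (i / p ℕ.* p)         ≈⟨ ^-homo-* (φ x) (i % p) (i / p ℕ.* p) ⟨
      φ x ^ᶠ (i % p ℕ.+ i / p ℕ.* p)                ≈⟨ ^-congʳ (φ x) (m≡m%n+[m/n]*n i p) ⟨
      φ x ^ᶠ i                                      ∎)
    (Span-* (power-sums φ-span (m%n<n i p)) (Span-frobenius (power-exponents k φ-span
      (m<n*o⇒m/o<n (≡.subst (i <_) (ℕ.*-comm p (p ^ k)) i<p^1+k)))))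

  -- Distinct values of L at m points give m cosets of its kernel, hence m p ^ d ≤ p ^ n; interpolating
  -- at these values gives h.
  factor-through : ∀ {k d g} {b : Vector Carrier d} (b-indep : Independent b) → k ℕ.+ d ≡ n →
    (∀ {x y} → x ≈ y → g x ≈ g y) → (∀ x a → g (x + linearCombination a b) ≈ g x) →
    Σ[ m ∈ ℕ ] m ≤ p ^ k × Σ[ h ∈ Vector Carrier m ] (∀ x → eval h (Annihilator.L (annihilator b-indep) x) ≈ g x)
  factor-through {k} {d} {g} {b} b-indep k+d≡n g-cong g-periodic = m , m≤p^k , h , λ x →
    let i , Lx≈Lrep = covering x in begin
      eval h (L x)            ≈⟨ eval-cong h Lx≈Lrep ⟩
      eval h (L (rep i))      ≈⟨ proj₂ interpolant i ⟩
      g (rep i)               ≈⟨ g-constant Lx≈Lrep ⟨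
      g x                     ∎
    where
    open Annihilator (annihilator b-indep)

    -- Identifying elements with equal value under `L` makes the classes the cosets of the kernel;
    -- deduplication then selects one representative of each.
    kernelSetoid : DecSetoid c ℓ
    kernelSetoid = On.decSetoid
      (record { isDecEquivalence = record { isEquivalence = isEquivalence ; _≟_ = _≟_ } }) L

    open DecSetoid kernelSetoid using () renaming (setoid to S; _≟_ to _≟ᴸ_; trans to ∼-trans)

    reps : List Carrier
    reps = List.deduplicate _≟ᴸ_ (List.tabulate element)

    m : ℕ
    m = length reps

    rep : Fin m → Carrier
    rep = List.lookup reps

    rep-injective : Injective _≡_ _≈_ (L ∘ rep)
    rep-injective eq = lookup-injective (λ x≁y y∼x → x≁y (sym y∼x))
      (deduplicate-! kernelSetoid (List.tabulate element)) (λ rep≁rep → rep≁rep eq)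

    covering : ∀ x → ∃[ i ] L x ≈ L (rep i)
    covering x = Any.index x∈reps , lookup-index x∈reps
      where
      x∈reps = Membershipₛ.∈-deduplicate⁺ S _≟ᴸ_ (λ y∼z w∼y → ∼-trans w∼y (sym y∼z))
        (Membershipₛ.∈-resp-≈ S (cong (element-surjective x)) (Membershipₛ.∈-tabulate⁺ S {f = element} (index x)))

    m*p^d≤p^n : m ℕ.* p ^ d ≤ p ^ n
    m*p^d≤p^n = Fin.injective⇒≤ {f = λ i → index (point (Fin.remQuot (p ^ d) i))} λ {i} {j} eq →
      ≡.trans (≡.sym (Fin.combine-remQuot {m} (p ^ d) i)) (≡.trans
        (≡.cong (λ (s , t) → Fin.combine s t) (point-injective _ _ (index-injective eq)))
        (Fin.combine-remQuot {m} (p ^ d) j))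
      where
      point : Fin m × Fin (p ^ d) → Carrier
      point (s , t) = rep s + linearCombination (finToFun t) b

      L-point : ∀ s t → L (point (s , t)) ≈ L (rep s)
      L-point s t = trans (+-homo _ _) (trans (+-congˡ (vanishes (finToFun t))) (+-identityʳ _))

      -- `L` forgets the span component, so it recovers the representative; cancelling that leaves
      -- the coordinates.
      point-injective : ∀ u v → point u ≈ point v → u ≡ v
      point-injective (s , t) (s′ , t′) eq
        with rep-injective (trans (sym (L-point s t)) (trans (cong eq) (L-point s′ t′)))
      ... | ≡.refl = ≡.cong (s ,_)
        (finToFun-injective {d} {p} (linearCombination-injective {b = b} b-indep (∙-cancelˡ (rep s) _ _ eq)))

    m≤p^k : m ≤ p ^ k
    m≤p^k = ℕ.*-cancelʳ-≤ m (p ^ k) (p ^ d) {{ℕ.m^n≢0 p d}}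
      (≡.subst (m ℕ.* p ^ d ≤_) (≡.trans (≡.cong (p ^_) (≡.sym k+d≡n)) (ℕ.^-distribˡ-+-* p k d)) m*p^d≤p^n)

    interpolant : Σ[ h ∈ Vector Carrier m ] (∀ i → eval h (L (rep i)) ≈ g (rep i))
    interpolant = interpolate (L ∘ rep) (g ∘ rep) rep-injective

    h : Vector Carrier m
    h = proj₁ interpolant

    -- Arguments with the same value under `L` differ by a kernel element, that is, by a period of
    -- `g`.
    g-constant : ∀ {x y} → L x ≈ L y → g x ≈ g y
    g-constant {x} {y} Lx≈Ly with kernel (trans (∸-homo x y) (x≈y⇒x-y≈0 Lx≈Ly))
    ... | a , a∙b≈x-y = begin
      g x                               ≈⟨ g-cong (xyx⁻¹≈y y x) ⟨
      g (y + x - y)                     ≈⟨ g-cong (+-assoc y x (- y)) ⟩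
      g (y + (x - y))                   ≈⟨ g-cong (+-congˡ a∙b≈x-y) ⟨
      g (y + linearCombination a b)     ≈⟨ g-periodic y a ⟩
      g y                               ∎

  periodic⇒Span : ∀ {k d g} {b : Vector Carrier d} → Independent b → k ℕ.+ d ≡ n →
    (∀ {x y} → x ≈ y → g x ≈ g y) → (∀ x a → g (x + linearCombination a b) ≈ g x) → Span (exponents d k) g
  periodic⇒Span {k} b-indep k+d≡n g-cong g-periodic with factor-through {k} b-indep k+d≡n g-cong g-periodic
  ... | m , m≤p^k , h , h∘L≈g = resp h∘L≈g (Span-sum λ i →
    h i *ˢ power-exponents k linearised (ℕ.<-≤-trans (Fin.toℕ<n i) m≤p^k))
    where open Annihilator (annihilator b-indep)

  -- From exponents to the weight

  Span⇒polynomial : ∀ {E φ m} → (∀ {e} → e ∈ E → e < m) → Span E φ →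
    Σ[ P ∈ Vector Carrier m ] (∀ x → eval P x ≈ φ x) × (∀ i → ¬ (P i ≈ 0#) → toℕ i ∈ E)
  Span⇒polynomial E<m (monomial a {e} e∈E) = unit i a
    , (λ x → trans (eval-unit i a x) (*-congˡ (^-congʳ x i≡e)))
    , λ j Pj≉0 → support j Pj≉0
    where
    i   = fromℕ< (E<m e∈E)
    i≡e = Fin.toℕ-fromℕ< (E<m e∈E)

    support : ∀ j → ¬ (unit i a j ≈ 0#) → toℕ j ∈ _
    support j Pj≉0 with i Fin.≟ j
    ... | yes ≡.refl = ≡.subst (_∈ _) (≡.sym i≡e) e∈E
    ... | no  i≢j    = contradiction (unit-≢ i a i≢j) Pj≉0
  Span⇒polynomial {m = m} E<m 0ˢ = (λ _ → 0#)
    , eval-0 m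
    , λ i 0≉0 → contradiction refl 0≉0
  Span⇒polynomial E<m (s +ˢ t) with Span⇒polynomial E<m s | Span⇒polynomial E<m t
  ... | P , P≈ , P-support | Q , Q≈ , Q-support = (λ i → P i + Q i)
    , (λ x → trans (eval-+ P Q x) (+-cong (P≈ x) (Q≈ x)))
    , support
    where
    -- Cancellation may shrink the support, so only an inclusion in `E` is tracked; a nonzero sum
    -- has a nonzero summand.
    support : ∀ i → ¬ (P i + Q i ≈ 0#) → toℕ i ∈ _
    support i P+Q≉0 with P i ≟ 0#
    ... | yes Pi≈0 = Q-support i λ Qi≈0 → P+Q≉0 (trans (+-cong Pi≈0 Qi≈0) (+-identityˡ 0#))
    ... | no  Pi≉0 = P-support i Pi≉0
  Span⇒polynomial E<m (resp φ≈ψ s) with Span⇒polynomial E<m s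
  ... | P , P≈ , P-support = P , (λ x → trans (P≈ x) (φ≈ψ x)) , P-support

  -- Uniqueness of the interpolating polynomial identifies the coefficients of `P` with those of
  -- `polynomial f`, which carries the support bound over.
  weight≤length : ∀ {E} f → (∀ {e} → e ∈ E → e < p ^ n) → Span E (Func.to f) → weight f ≤ length E
  weight≤length {E} f E<q f-span with Span⇒polynomial E<q f-span
  ... | P , P≈f , P-support = count≤length (λ a → ¬? (a ≟ 0#)) (polynomial f) E λ i fi≉0 →
    P-support i λ Pi≈0 → fi≉0 (trans (proj₂ (proj₂ (interpolation f)) P≈f i) Pi≈0)

  -- Maps of bounded codimension

  module Codim {f : Func setoid setoid} {k : ℕ} (f-codim : CodimAtMost f k) where

    open CodimAtMost f-codim
    open Func f using (to) renaming (cong to to-cong)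
    private module U = IsSubspace subspace

    b : Vector Carrier (n ∸ k)
    b = proj₁ dimension

    open IsBasis (proj₂ dimension) using (members; independent)

    M-additive : IsAdditive M
    M-additive = record { cong = ⟦⟧-cong ; +-homo = +ᴹ-homo }
      where open IsLinear linear using (⟦⟧-cong; +ᴹ-homo)

    linearCombination∈U : ∀ {d} (b : Vector Carrier d) → (∀ i → U (b i)) → ∀ a → U (linearCombination a b)
    linearCombination∈U {zero}  b b∈U a = U.0-closed
    linearCombination∈U {suc d} b b∈U a =
      U.+-closed (U.·-closed (head a) (b∈U zero)) (linearCombination∈U (tail b) (b∈U ∘ suc) (tail a))

    f-M-cong : ∀ {x y} → x ≈ y → to x - M x ≈ to y - M y
    f-M-cong x≈y = +-cong (to-cong x≈y) (-‿cong (IsAdditive.cong M-additive x≈y))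

    f-M-periodic : ∀ x a → to (x + linearCombination a b) - M (x + linearCombination a b) ≈ to x - M x
    f-M-periodic x a = trans (constant x (linearCombination∈U b members a) U.0-closed) (f-M-cong (+-identityʳ x))

    f-M-Span : Span (exponents (n ∸ k) k) (λ x → to x - M x)
    f-M-Span = periodic⇒Span {k} {b = b} independent (ℕ.m+[n∸m]≡n k≤n) f-M-cong f-M-periodic

    -- `E` is left open because the two cases differ: for `k = 0` the two lists have to be
    -- concatenated, while for `k ≥ 1` the exponents of `f - M` already include those of `M`.
    f-Span : ∀ {E} → (∀ {e} → e ∈ exponents (n ∸ k) k → e ∈ E) → (∀ {e} → e ∈ powers n → e ∈ E) → Span E to
    f-Span exponents⊆E powers⊆E = resp
      (λ x → trans (sym (+-assoc (M x) (to x) (- M x))) (xyx⁻¹≈y (M x) (to x)))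
      (Span-⊆ powers⊆E (additive⇒linearised M-additive) +ˢ Span-⊆ exponents⊆E f-M-Span)

  -- In codimension 0 the difference `f - M` is constant and `exponents n 0` consists of 0 alone.
  -- Beside the `n` exponents `p ^ j` of `M`, this constant term accounts for the `+ 1`.
  weight-linearised : ∀ f → CodimAtMost f 0 → weight f ≤ n ℕ.+ 1
  weight-linearised f f-codim = ℕ.≤-trans
    (weight≤length f bound (f-Span (∈-++⁺ʳ (powers n)) ∈-++⁺ˡ))
    (ℕ.≤-reflexive (≡.trans (List.length-++ (powers n)) (≡.cong (ℕ._+ 1) (List.length-applyUpTo (p ^_) n))))
    where
    open Codim f-codim
    bound : ∀ {e} → e ∈ powers n ++ exponents n 0 → e < p ^ n
    bound e∈ with ∈-++⁻ (powers n) e∈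
    ... | inj₁ e∈powers    = powers-bound 1<p e∈powers
    ... | inj₂ e∈exponents = exponents-bound 1<p n 0 e∈exponents

  weight≤exponents : ∀ f k → CodimAtMost f (suc k) → weight f ≤ length (exponents (n ∸ suc k) (suc k))
  weight≤exponents f k f-codim = weight≤length f
    (λ e∈ → ≡.subst (λ m → _ < p ^ m) 1+k+d≡n (exponents-bound 1<p (n ∸ suc k) (suc k) e∈))
    (f-Span id (λ e∈ → powers⊆exponents 1<p (n ∸ suc k) k (≡.subst (λ m → _ ∈ powers m) (≡.sym 1+k+d≡n) e∈)))
    where
    open Codim f-codim
    1+k+d≡n : suc k ℕ.+ (n ∸ suc k) ≡ n
    1+k+d≡n = ℕ.m+[n∸m]≡n (CodimAtMost.k≤n f-codim)

-- The index is only known as a power of `p`; this recovers the codimension from it.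
^-injectiveʳ : ∀ {p k l} → 1 < p → p ^ k ≡ p ^ l → k ≡ l
^-injectiveʳ {p} {k} {l} 1<p eq with ℕ.<-cmp k l
... | tri< k<l _ _ = contradiction eq (ℕ.<⇒≢ (ℕ.^-monoʳ-< p 1<p k<l))
... | tri≈ _ k≡l _ = k≡l
... | tri> _ _ l<k = contradiction (≡.sym eq) (ℕ.<⇒≢ (ℕ.^-monoʳ-< p 1<p l<k))

open import Data.Nat using (_+_)
open import Data.Nat.Properties using (m<n⇒0<n∸m)

theorem4 : ∀ {c ℓ} (p n : ℕ) → Prime p → 1 ≤ n →
    (F : FiniteField c ℓ (p ^ n)) →
    (f : Func (FiniteField.setoid F) (FiniteField.setoid F)) →
    (k : ℕ) → AdditiveIndex.HasAdditiveIndex p n F f (p ^ k) →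
    (k ≡ 0 → Weight.weight F f ≤ n + 1) ×
    (1 ≤ k → (k<n : k < n) →
    Weight.weight F f ≤ (_/_ ((n ∸ k + 1) ^ p ∸ 1) (n ∸ k) {{>-nonZero (m<n⇒0<n∸m k<n)}}) ^ k)
theorem4 p n p-prime 1≤n F f k (k′ , (f-codim , _) , p^k≡p^k′)
  with ^-injectiveʳ {p} {k} {k′} (Field.1<p p n p-prime F) p^k≡p^k′
... | ≡.refl = (λ { ≡.refl → weight-linearised f f-codim })
             , λ { (s≤s {n = k} z≤n) k<n → ℕ.≤-trans (weight≤exponents f k f-codim)
                 (ℕ.≤-reflexive (≡.trans (length-exponents (n ∸ suc k) (suc k)) (≡.cong (_^ suc k)
                   (length-sums-/ (n ∸ suc k) p {{>-nonZero (m<n⇒0<n∸m k<n)}})))) }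
  where open Field p n p-prime F
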